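{- For every positive integer $k$ there exist constants $c_k,C_k>0$ such that for all sufficiently large $n$, \[ D(n,k)\geq c_k\,\frac{n^{2\lfloor k/3\rfloor}}{e^{C_k\sqrt{\log n}}}. \]
   Context: All graphs are finite, simple and undirected. For a graph $G$ and an integer $k\geq 1$, the $k$-configuration graph $\mathcal{R}_k(G)$ (token jumping model) is the graph whose vertices are the independent sets of $G$ of size exactly $k$, where two such independent sets $I,J$ are adjacent if and only if $|I\cap J|=k-1$. $D(n,k)$ denotes the maximum, over all graphs $G$ on $n$ vertices, of the largest diameter of a connected component of $\mathcal{R}_k(G)$. -}

module Defs where

open import Data.Nat using (ℕ; zero; suc; _∸_; _≤_; _*_; _^_)
open import Data.Bool using (Bool; false)
open import Data.Fin using (Fin)
open import Data.Fin.Subset using (Subset; _∈_; _∩_; ∣_∣)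
open import Data.Product using (Σ; ∃; _×_; proj₁)
open import Relation.Binary.PropositionalEquality using (_≡_)

record Graph (n : ℕ) : Set where
  field
    adj     : Fin n → Fin n → Bool
    sym     : ∀ i j → adj i j ≡ adj j i
    irrefl  : ∀ i → adj i i ≡ false
open Graph public

Independent : ∀ {n} → Graph n → Subset n → Set
Independent G I = ∀ i j → i ∈ I → j ∈ I → adj G i j ≡ false

KIndSet : ∀ {n} → Graph n → ℕ → Set
KIndSet {n} G k = Σ (Subset n) (λ I → Independent G I × ∣ I ∣ ≡ k)

-- adjacency in R_k(G) (token jumping): |I ∩ J| = k - 1
RAdj : ∀ {n} (G : Graph n) (k : ℕ) → KIndSet G k → KIndSet G k → Set
RAdj G k I J = ∣ proj₁ I ∩ proj₁ J ∣ ≡ k ∸ 1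

data Walk {n} (G : Graph n) (k : ℕ) : KIndSet G k → KIndSet G k → ℕ → Set where
  nil  : ∀ {X} → Walk G k X X zero
  cons : ∀ {X Y Z ℓ} → RAdj G k X Y → Walk G k Y Z ℓ → Walk G k X Z (suc ℓ)

-- G has two vertices X, Y of R_k(G) in the same component (joined by some walk)
-- whose distance satisfies P, i.e. every walk from X to Y has a length satisfying P.
-- For monotone P, "∃ G on n vertices with HasPairAtDistance G k P" says
-- exactly that P (D(n,k)) holds, since D(n,k) is a maximum over finitely many
-- distances between vertices in a common component.
HasPairAtDistance : ∀ {n} → Graph n → ℕ → (ℕ → Set) → Set
HasPairAtDistance G k P =
  Σ (KIndSet G k) λ X → Σ (KIndSet G k) λ Y →
    (∃ λ ℓ → Walk G k X Y ℓ) × (∀ ℓ → Walk G k X Y ℓ → P ℓ)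

{-# OPTIONS --safe #-}
module Submission where

open import Defs hiding (sym)
open import Data.Bool using (false; not)
open import Data.Empty using (⊥-elim)
open import Data.Fin using (Fin; zero; suc; toℕ; fromℕ; fromℕ<; combine; funToFin; finToFun; inject≤; punchIn)
import Data.Fin as F
import Data.Fin.Properties as Fin
open import Data.Fin.Subset using (Subset; inside; outside; _∈_; _⊆_; ⊤; ⊥; ⁅_⁆; _∪_; _∩_; ∣_∣) renaming (_-_ to _∖_)
open import Data.Fin.Subset.Properties
open import Data.Nat using (ℕ; zero; suc; pred; _+_; _*_; _∸_; _^_; _/_; _%_; _≤_; _<_; z≤n; s≤s; z<s; NonZero; >-nonZero; _≟_; _<?_; ∣_-_∣; ⌊_/2⌋; ⌈_/2⌉)
open import Data.Nat.DivMod
open import Data.Nat.Divisibility using (n∣m*n)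
open import Data.Nat.Induction using (<-rec)
open import Data.Nat.Logarithm using (⌈log₂_⌉; ⌈log₂⌉-mono-≤; ⌈log₂⌈n/2⌉⌉≡⌈log₂n⌉∸1; ⌈log₂2^n⌉≡n)
open import Data.Nat.Properties
open import Data.Nat.Tactic.RingSolver using (solve-∀)
open import Algebra.Properties.CommutativeSemigroup +-commutativeSemigroup using (interchange)
open import Data.Product using (Σ; ∃; _×_; _,_; proj₁; proj₂)
open import Data.Sum using (_⊎_; inj₁; inj₂; swap)
open import Data.Vec using ([]; _∷_; here; there)
open import Function using (_∘_; mk⇔)
open import Relation.Binary.Definitions using (tri<; tri≈; tri>)
open import Relation.Binary.PropositionalEquality using (_≡_; _≢_; refl; sym; trans; cong; cong₂; subst; subst₂; module ≡-Reasoning)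
open import Relation.Nullary using (Dec; yes; no; does; contradiction)
open import Relation.Nullary.Decidable using (_×-dec_; _⊎-dec_; ¬?; does-⇔; dec-true)

-- A k-element independent set of the constructed graph assigns one value to each of k variables, so R_k
-- is the solution graph of a binary constraint satisfaction problem in which one variable changes
-- at a time.  It is built to simulate an odometer with 2⌊k/3⌋ blocks of d digits in base Q: the
-- variables come in triples holding p, q and the checksum p + q for two blocks p, q (as vectors of
-- digits).  Every value also carries a tag: for each triple |q|² and p · q, the position of the next
-- carry, and the time modulo 3.  As in Behrend's construction, strict convexity of the norm lets
-- pairwise constraints enforce the checksum: three pairwise consistent values come from one (p, q).
-- Hence no single variable can change its digits except by following the odometer, and the odometer
-- reading is a potential that changes by at most 1 along each edge.  With d = x and Q = 2^x, x close
-- to √(log n), tags only cost a factor 2^O(x), while the odometer runs through 2^(2⌊k/3⌋x²) readings.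

[r+b*Q]%Q≡r : ∀ {Q} .{{_ : NonZero Q}} r b → r < Q → (r + b * Q) % Q ≡ r
[r+b*Q]%Q≡r {Q} r b r<Q = trans ([m+kn]%n≡m%n r b Q) (m<n⇒m%n≡m r<Q)

[r+b*Q]/Q≡b : ∀ {Q} .{{_ : NonZero Q}} r b → r < Q → (r + b * Q) / Q ≡ b
[r+b*Q]/Q≡b {Q} r b r<Q =
  trans (+-distrib-/-∣ʳ r (n∣m*n b)) (cong₂ _+_ (m<n⇒m/n≡0 r<Q) (m*n/n≡m b Q))

-- Odometers

module Positional (Q : ℕ) .{{_ : NonZero Q}} where

  digit : ℕ → ℕ → ℕ
  digit w zero    = w % Q
  digit w (suc j) = digit (w / Q) j

  value : ℕ → (ℕ → ℕ) → ℕ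
  value zero    f = 0
  value (suc E) f = f 0 + value E (λ j → f (suc j)) * Q

  -- Truncated to the lowest E digits.
  carry : ℕ → ℕ → ℕ
  carry zero    w = 0
  carry (suc E) w with suc (w % Q) ≟ Q
  ... | yes _ = suc (carry E (w / Q))
  ... | no  _ = 0

  -- Incrementing with carry position J adds gain J j − loss J j to digit j.
  gain : ℕ → ℕ → ℕ
  gain zero    zero    = 1
  gain zero    (suc j) = 0
  gain (suc J) zero    = 0
  gain (suc J) (suc j) = gain J j

  loss : ℕ → ℕ → ℕ
  loss zero    j       = 0
  loss (suc J) zero    = pred Q
  loss (suc J) (suc j) = loss J j

  digit<Q : ∀ w j → digit w j < Q
  digit<Q w zero    = m%n<n w Q
  digit<Q w (suc j) = digit<Q (w / Q) j

  value-cong : ∀ E {f g : ℕ → ℕ} → (∀ j → j < E → f j ≡ g j) → value E f ≡ value E g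
  value-cong zero    f≡g = refl
  value-cong (suc E) f≡g =
    cong₂ _+_ (f≡g 0 z<s) (cong (_* Q) (value-cong E (λ j j<E → f≡g (suc j) (s≤s j<E))))

  value-digit : ∀ E w → w < Q ^ E → value E (digit w) ≡ w
  value-digit zero    w w<1 = sym (n<1⇒n≡0 w<1)
  value-digit (suc E) w w<Q^ = begin
    w % Q + value E (digit (w / Q)) * Q
      ≡⟨ cong (λ v → w % Q + v * Q) (value-digit E (w / Q) (m<n*o⇒m/o<n (subst (w <_) (*-comm Q (Q ^ E)) w<Q^))) ⟩
    w % Q + w / Q * Q
      ≡⟨ sym (m≡m%n+[m/n]*n w Q) ⟩
    w ∎
    where open ≡-Reasoning

  carry≤E : ∀ E w → carry E w ≤ E
  carry≤E zero    w = z≤n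
  carry≤E (suc E) w with suc (w % Q) ≟ Q
  ... | yes _ = s≤s (carry≤E E (w / Q))
  ... | no  _ = z≤n

  suc≡suc%+ : ∀ w → suc w ≡ suc (w % Q) + w / Q * Q
  suc≡suc%+ w = cong suc (m≡m%n+[m/n]*n w Q)

  suc-divMod-carry : ∀ w → suc (w % Q) ≡ Q → suc w % Q ≡ 0 × suc w / Q ≡ suc (w / Q)
  suc-divMod-carry w eq =
    trans (cong (_% Q) suc-w) ([r+b*Q]%Q≡r 0 (suc (w / Q)) 0<Q) ,
    trans (cong (_/ Q) suc-w) ([r+b*Q]/Q≡b 0 (suc (w / Q)) 0<Q)
    where
    0<Q : 0 < Q
    0<Q = subst (0 <_) eq z<s
    suc-w : suc w ≡ suc (w / Q) * Q
    suc-w = trans (suc≡suc%+ w) (cong (_+ w / Q * Q) eq)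

  suc-divMod-noCarry : ∀ w → suc (w % Q) ≢ Q → suc w % Q ≡ suc (w % Q) × suc w / Q ≡ w / Q
  suc-divMod-noCarry w neq =
    trans (cong (_% Q) (suc≡suc%+ w)) ([r+b*Q]%Q≡r _ (w / Q) r<Q) ,
    trans (cong (_/ Q) (suc≡suc%+ w)) ([r+b*Q]/Q≡b _ (w / Q) r<Q)
    where
    r<Q : suc (w % Q) < Q
    r<Q = ≤∧≢⇒< (m%n<n w Q) neq

  sucw/Q<Q^E : ∀ E w → suc w < Q ^ suc E → suc w / Q < Q ^ E
  sucw/Q<Q^E E w lt = m<n*o⇒m/o<n (subst (suc w <_) (*-comm Q (Q ^ E)) lt)

  -- As `suc w` still fits into E digits, the carry stops before the truncation in `carry` is felt.
  -- Losses stand on the left to avoid subtraction in ℕ.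
  digit-suc : ∀ E w → suc w < Q ^ E → ∀ j →
    digit (suc w) j + loss (carry E w) j ≡ digit w j + gain (carry E w) j
  digit-suc zero    w (s≤s ()) j
  digit-suc (suc E) w lt j with suc (w % Q) ≟ Q
  digit-suc (suc E) w lt zero | yes eq =
    trans (cong₂ _+_ (proj₁ (suc-divMod-carry w eq)) (cong pred (sym eq))) (sym (+-identityʳ _))
  digit-suc (suc E) w lt (suc j) | yes eq =
    trans (cong (λ v → digit v j + loss (carry E (w / Q)) j) (proj₂ (suc-divMod-carry w eq)))
      (digit-suc E (w / Q) (subst (_< Q ^ E) (proj₂ (suc-divMod-carry w eq)) (sucw/Q<Q^E E w lt)) j)
  digit-suc (suc E) w lt zero | no neq =
    trans (+-identityʳ _) (trans (proj₁ (suc-divMod-noCarry w neq)) (+-comm 1 _))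
  digit-suc (suc E) w lt (suc j) | no neq =
    cong (λ v → digit v j + 0) (proj₂ (suc-divMod-noCarry w neq))

  carry<E : ∀ E w → suc w < Q ^ E → carry E w < E
  carry<E zero    w (s≤s ())
  carry<E (suc E) w lt with suc (w % Q) ≟ Q
  ... | yes eq = s≤s (carry<E E (w / Q) (subst (_< Q ^ E) (proj₂ (suc-divMod-carry w eq)) (sucw/Q<Q^E E w lt)))
  ... | no  _  = z<s

  -- At a digit j below J, adding `pred Q` to `g j` must stay below Q, so `f j` is Q - 1 and `g j`
  -- is 0. Nothing is asked about the origin of the digits, because `potential` takes them from
  -- different times.
  value-suc : ∀ E J {f g : ℕ → ℕ} → J < E → (∀ j → j < E → f j < Q) →
    (∀ j → j < E → g j + loss J j ≡ f j + gain J j) → value E g ≡ suc (value E f)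
  value-suc (suc E) zero {f} {g} _ f<Q rel =
    cong₂ (λ x y → x + y * Q)
      (trans (sym (+-identityʳ _)) (trans (rel 0 z<s) (+-comm _ 1)))
      (value-cong E λ j j<E → +-cancelʳ-≡ 0 (g (suc j)) (f (suc j)) (rel (suc j) (s≤s j<E)))
  value-suc (suc E) (suc J) {f} {g} (s≤s J<E) f<Q rel = begin
    g 0 + value E (λ j → g (suc j)) * Q
      ≡⟨ cong₂ (λ x y → x + y * Q) g0≡0 (value-suc E J J<E (λ j j<E → f<Q (suc j) (s≤s j<E)) (λ j j<E → rel (suc j) (s≤s j<E))) ⟩
    Q + value E (λ j → f (suc j)) * Q
      ≡⟨ cong (_+ value E (λ j → f (suc j)) * Q) (sym (trans (cong suc f0≡) (suc-pred Q))) ⟩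
    suc (f 0 + value E (λ j → f (suc j)) * Q) ∎
    where
    open ≡-Reasoning
    rel0 : g 0 + pred Q ≡ f 0
    rel0 = trans (rel 0 z<s) (+-identityʳ _)
    f0≡ : f 0 ≡ pred Q
    f0≡ = ≤-antisym (<⇒≤pred (f<Q 0 z<s)) (subst (pred Q ≤_) rel0 (m≤n+m (pred Q) (g 0)))
    g0≡0 : g 0 ≡ 0
    g0≡0 = +-cancelʳ-≡ (pred Q) (g 0) 0 (trans rel0 f0≡)

-- Checksums

∑< : ℕ → (ℕ → ℕ) → ℕ
∑< zero    f = 0
∑< (suc d) f = f d + ∑< d f

∑<-cong : ∀ d {f g : ℕ → ℕ} → (∀ c → c < d → f c ≡ g c) → ∑< d f ≡ ∑< d g
∑<-cong zero    f≡g = refl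
∑<-cong (suc d) f≡g = cong₂ _+_ (f≡g d (n<1+n d)) (∑<-cong d (λ c c<d → f≡g c (m<n⇒m<1+n c<d)))

∑<-+ : ∀ d (f g : ℕ → ℕ) → ∑< d (λ c → f c + g c) ≡ ∑< d f + ∑< d g
∑<-+ zero    f g = refl
∑<-+ (suc d) f g = trans (cong (f d + g d +_) (∑<-+ d f g)) (interchange (f d) (g d) (∑< d f) (∑< d g))

∑<-≤ : ∀ d {f : ℕ → ℕ} {b} → (∀ c → f c ≤ b) → ∑< d f ≤ d * b
∑<-≤ zero    f≤b = z≤n
∑<-≤ (suc d) f≤b = +-mono-≤ (f≤b d) (∑<-≤ d f≤b)

∑<≡0⇒≡0 : ∀ d {f : ℕ → ℕ} → ∑< d f ≡ 0 → ∀ c → c < d → f c ≡ 0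
∑<≡0⇒≡0 (suc d) {f} eq c c<1+d with c ≟ d
... | yes refl = m+n≡0⇒m≡0 (f c) eq
... | no  c≢d  = ∑<≡0⇒≡0 d (m+n≡0⇒n≡0 (f d) eq) c (≤∧≢⇒< (≤-pred c<1+d) c≢d)

-- This is (a - b)² = a² - 2ab + b² without signed numbers; the induction lowers both arguments
-- together, which leaves their distance unchanged.
square-difference : ∀ a b → a * a + b * b ≡ (a * b + a * b) + ∣ a - b ∣ * ∣ a - b ∣
square-difference zero    b       = refl
square-difference (suc a) zero    = identity a
  where
  identity : ∀ a → suc a * suc a + 0 ≡ (a * 0 + a * 0) + suc a * suc a
  identity = solve-∀
square-difference (suc a) (suc b) = begin
  suc a * suc a + suc b * suc b                       ≡⟨ lhs a b ⟩
  (a * a + b * b) + (a + a + (b + b) + 2)             ≡⟨ cong (_+ (a + a + (b + b) + 2)) (square-difference a b) ⟩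
  a * b + a * b + δ * δ + (a + a + (b + b) + 2)       ≡⟨ rhs a b δ ⟩
  suc a * suc b + suc a * suc b + δ * δ               ∎
  where
  open ≡-Reasoning
  δ : ℕ
  δ = ∣ a - b ∣
  lhs : ∀ a b → suc a * suc a + suc b * suc b ≡ (a * a + b * b) + (a + a + (b + b) + 2)
  lhs = solve-∀
  rhs : ∀ a b δ → a * b + a * b + δ * δ + (a + a + (b + b) + 2) ≡ suc a * suc b + suc a * suc b + δ * δ
  rhs = solve-∀

-- The equality case of Cauchy–Schwarz for vectors of equal norm.
equal-norms-and-product⇒≡ : ∀ d (u v : ℕ → ℕ) →
  ∑< d (λ c → u c * u c) ≡ ∑< d (λ c → v c * v c) →
  ∑< d (λ c → u c * v c) ≡ ∑< d (λ c → u c * u c) →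
  ∀ c → c < d → u c ≡ v c
equal-norms-and-product⇒≡ d u v norms product c c<d =
  ∣m-n∣≡0⇒m≡n (square≡0 (∑<≡0⇒≡0 d vanishing c c<d))
  where
  open ≡-Reasoning
  uu uv vv δδ : ℕ → ℕ
  uu c = u c * u c
  uv c = u c * v c
  vv c = v c * v c
  δδ c = ∣ u c - v c ∣ * ∣ u c - v c ∣
  square≡0 : ∀ {m} → m * m ≡ 0 → m ≡ 0
  square≡0 {zero} _ = refl
  vanishing : ∑< d δδ ≡ 0
  vanishing = +-cancelˡ-≡ (∑< d uv + ∑< d uv) _ _ (begin
    ∑< d uv + ∑< d uv + ∑< d δδ             ≡⟨ cong (_+ ∑< d δδ) (sym (∑<-+ d uv uv)) ⟩
    ∑< d (λ c → uv c + uv c) + ∑< d δδ      ≡⟨ sym (∑<-+ d (λ c → uv c + uv c) δδ) ⟩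
    ∑< d (λ c → uv c + uv c + δδ c)         ≡⟨ ∑<-cong d (λ c _ → sym (square-difference (u c) (v c))) ⟩
    ∑< d (λ c → uu c + vv c)                ≡⟨ ∑<-+ d uu vv ⟩
    ∑< d uu + ∑< d vv                       ≡⟨ cong₂ _+_ (sym product) (trans (sym norms) (sym product)) ⟩
    ∑< d uv + ∑< d uv                       ≡⟨ sym (+-identityʳ _) ⟩
    ∑< d uv + ∑< d uv + 0                   ∎)

-- From p + q′ = p′ + q and p′ · q = p · q one gets q · q′ = q · q, so the norms force q = q′.
checksum-rigid : ∀ d (p q p′ q′ : ℕ → ℕ) →
  (∀ c → c < d → p c + q′ c ≡ p′ c + q c) →
  ∑< d (λ c → q c * q c) ≡ ∑< d (λ c → q′ c * q′ c) →
  ∑< d (λ c → p c * q c) ≡ ∑< d (λ c → p′ c * q c) →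
  ∀ c → c < d → q c ≡ q′ c
checksum-rigid d p q p′ q′ sums norms products =
  equal-norms-and-product⇒≡ d q q′ norms (+-cancelˡ-≡ (∑< d (λ c → p c * q c)) _ _ (begin
    ∑< d (λ c → p c * q c) + ∑< d (λ c → q c * q′ c)   ≡⟨ sym (∑<-+ d _ _) ⟩
    ∑< d (λ c → p c * q c + q c * q′ c)                ≡⟨ ∑<-cong d termwise ⟩
    ∑< d (λ c → p′ c * q c + q c * q c)                ≡⟨ ∑<-+ d _ _ ⟩
    ∑< d (λ c → p′ c * q c) + ∑< d (λ c → q c * q c)   ≡⟨ cong (_+ ∑< d (λ c → q c * q c)) (sym products) ⟩
    ∑< d (λ c → p c * q c) + ∑< d (λ c → q c * q c)    ∎))
  where
  open ≡-Reasoning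
  factor : ∀ a b e → a * e + e * b ≡ (a + b) * e
  factor = solve-∀
  termwise : ∀ c → c < d → p c * q c + q c * q′ c ≡ p′ c * q c + q c * q c
  termwise c c<d = begin
    p c * q c + q c * q′ c    ≡⟨ factor (p c) (q′ c) (q c) ⟩
    (p c + q′ c) * q c        ≡⟨ cong (_* q c) (sums c c<d) ⟩
    (p′ c + q c) * q c        ≡⟨ sym (factor (p′ c) (q c) (q c)) ⟩
    p′ c * q c + q c * q c    ∎

-- What variable m sees of the blocks f: variables 3i, 3i+1, 3i+2 see f (2i), f (2i+1) and their sum.
form : ℕ → (ℕ → ℕ) → ℕ
form 0 f = f 0
form 1 f = f 1
form 2 f = f 0 + f 1
form (suc (suc (suc m))) f = form m (λ b → f (suc (suc b)))

form-cong : ∀ m {f g : ℕ → ℕ} → (∀ b → f b ≡ g b) → form m f ≡ form m g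
form-cong 0 f≡g = f≡g 0
form-cong 1 f≡g = f≡g 1
form-cong 2 f≡g = cong₂ _+_ (f≡g 0) (f≡g 1)
form-cong (suc (suc (suc m))) f≡g = form-cong m (λ b → f≡g (suc (suc b)))

-- Linearity lets gains and losses of digits act on what a variable sees; `content-suc` rests on it.
form-+ : ∀ m (f g : ℕ → ℕ) → form m (λ b → f b + g b) ≡ form m f + form m g
form-+ 0 f g = refl
form-+ 1 f g = refl
form-+ 2 f g = interchange (f 0) (g 0) (f 1) (g 1)
form-+ (suc (suc (suc m))) f g = form-+ m (λ b → f (suc (suc b))) (λ b → g (suc (suc b)))

form-< : ∀ m {f : ℕ → ℕ} {Q} → (∀ b → f b < Q) → form m f < Q + Q
form-< 0 {f} {Q} f<Q = <-≤-trans (f<Q 0) (m≤m+n Q Q)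
form-< 1 {f} {Q} f<Q = <-≤-trans (f<Q 1) (m≤m+n Q Q)
form-< 2 f<Q = +-mono-< (f<Q 0) (f<Q 1)
form-< (suc (suc (suc m))) f<Q = form-< m (λ b → f<Q (suc (suc b)))

form-first : ∀ i (f : ℕ → ℕ) → form (i * 3) f ≡ f (i * 2)
form-first zero    f = refl
form-first (suc i) f = form-first i (λ b → f (suc (suc b)))

form-second : ∀ i (f : ℕ → ℕ) → form (suc (i * 3)) f ≡ f (suc (i * 2))
form-second zero    f = refl
form-second (suc i) f = form-second i (λ b → f (suc (suc b)))

form-sum : ∀ i (f : ℕ → ℕ) → form (suc (suc (i * 3))) f ≡ f (i * 2) + f (suc (i * 2))
form-sum zero    f = refl
form-sum (suc i) f = form-sum i (λ b → f (suc (suc b)))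

-- Cardinalities of subsets

-- Induct on X: its first element claims a partner m₀, which is deleted from T; injectivity leaves
-- the remaining elements their own partners.
∣∣≤-by-matching : ∀ {n k} (X : Subset n) (T : Subset k) (R : Fin n → Fin k → Set) →
  (∀ i → i ∈ X → ∃ λ m → m ∈ T × R i m) →
  (∀ i j m → i ∈ X → j ∈ X → R i m → R j m → i ≡ j) →
  ∣ X ∣ ≤ ∣ T ∣
∣∣≤-by-matching []            T R total inj = z≤n
∣∣≤-by-matching (outside ∷ X) T R total inj =
  ∣∣≤-by-matching X T (λ i → R (suc i)) (λ i i∈X → total (suc i) (there i∈X))
    (λ i j m i∈X j∈X r s → Fin.suc-injective (inj (suc i) (suc j) m (there i∈X) (there j∈X) r s))
∣∣≤-by-matching (inside ∷ X)  T R total inj with total zero here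
... | m₀ , m₀∈T , r₀ = ≤-trans (s≤s rest) (x∈p⇒∣p-x∣<∣p∣ m₀∈T)
  where
  rest : ∣ X ∣ ≤ ∣ T ∖ m₀ ∣
  rest = ∣∣≤-by-matching X (T ∖ m₀) (λ i → R (suc i))
    (λ i i∈X → let m , m∈T , r = total (suc i) (there i∈X) in
      m , x∈p∧x≢y⇒x∈p-y m∈T (λ { refl → Fin.0≢1+n (inj zero (suc i) m here (there i∈X) r₀ r) }) , r)
    (λ i j m i∈X j∈X r s → Fin.suc-injective (inj (suc i) (suc j) m (there i∈X) (there j∈X) r s))

not-does : ∀ {P : Set} (p? : Dec P) → not (does p?) ≡ false → P
not-does (yes p) _ = p

funToFin-injective : ∀ {a b} (f g : Fin a → Fin b) → funToFin f ≡ funToFin g → ∀ i → f i ≡ g i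
funToFin-injective f g eq i =
  trans (sym (Fin.finToFun-funToFin f i)) (trans (cong (λ x → finToFun x i) eq) (Fin.finToFun-funToFin g i))

image : ∀ {n k} → (Fin k → Fin n) → Subset n
image {k = zero}  u = ⊥
image {k = suc k} u = ⁅ u zero ⁆ ∪ image (λ m → u (suc m))

∈-image⁺ : ∀ {n k} (u : Fin k → Fin n) m → u m ∈ image u
∈-image⁺ u zero    = x∈p∪q⁺ (inj₁ (x∈⁅x⁆ (u zero)))
∈-image⁺ u (suc m) = x∈p∪q⁺ {p = ⁅ u zero ⁆} (inj₂ (∈-image⁺ (λ m → u (suc m)) m))

∈-image⁻ : ∀ {n k} (u : Fin k → Fin n) {i} → i ∈ image u → ∃ λ m → i ≡ u m
∈-image⁻ {k = zero}  u i∈ = ⊥-elim (∉⊥ i∈)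
∈-image⁻ {k = suc k} u i∈ with x∈p∪q⁻ ⁅ u zero ⁆ _ i∈
... | inj₁ i∈₀ = zero , x∈⁅y⁆⇒x≡y (u zero) i∈₀
... | inj₂ i∈ₛ = let m , eq = ∈-image⁻ (λ m → u (suc m)) i∈ₛ in suc m , eq

∣image∣ : ∀ {n k} (u : Fin k → Fin n) → (∀ m m′ → u m ≡ u m′ → m ≡ m′) → ∣ image u ∣ ≡ k
∣image∣ {n} {k} u inj = ≤-antisym
  (subst (∣ image u ∣ ≤_) (∣⊤∣≡n k)
    (∣∣≤-by-matching (image u) ⊤ (λ i m → i ≡ u m)
      (λ i i∈ → let m , eq = ∈-image⁻ u i∈ in m , ∈⊤ , eq)
      (λ i j m _ _ r s → trans r (sym s))))
  (subst (_≤ ∣ image u ∣) (∣⊤∣≡n k)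
    (∣∣≤-by-matching ⊤ (image u) (λ m i → i ≡ u m)
      (λ m _ → u m , ∈-image⁺ u m , refl)
      (λ m m′ i _ _ r s → inj m m′ (trans (sym r) s))))

∣⊤∖m∣<k : ∀ {k} (m : Fin k) → ∣ ⊤ ∖ m ∣ < k
∣⊤∖m∣<k {k} m = subst (∣ ⊤ ∖ m ∣ <_) (∣⊤∣≡n k) (x∈p⇒∣p-x∣<∣p∣ {x = m} ∈⊤)

∣⊤∖m∖m′∣<k∸1 : ∀ {k} (m m′ : Fin k) → m′ ≢ m → suc ∣ (⊤ ∖ m) ∖ m′ ∣ < k
∣⊤∖m∖m′∣<k∸1 m m′ neq = ≤-<-trans (x∈p⇒∣p-x∣<∣p∣ (x∈p∧x≢y⇒x∈p-y ∈⊤ neq)) (∣⊤∖m∣<k m)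

-- A common element has the same index in both images, and that index is not m₀; conversely
-- `punchIn m₀` lists the K other indices. Token jumps of the canonical walk are verified this way.
∣image∩image∣ : ∀ {n K} (u u′ : Fin (suc K) → Fin n) m₀ → (∀ m m′ → u m ≡ u′ m′ → m ≡ m′) →
  (∀ m m′ → u m ≡ u m′ → m ≡ m′) → u m₀ ≢ u′ m₀ → (∀ m → m ≢ m₀ → u m ≡ u′ m) →
  ∣ image u ∩ image u′ ∣ ≡ K
∣image∩image∣ {n} {K} u u′ m₀ cross inj differ agree = ≤-antisym
  (≤-pred (≤-<-trans
    (∣∣≤-by-matching (image u ∩ image u′) (⊤ ∖ m₀) (λ i m → i ≡ u m)
      (λ i i∈ → let i∈u , i∈u′ = x∈p∩q⁻ (image u) (image u′) i∈
                    m , eq = ∈-image⁻ u i∈u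
                    m′ , eq′ = ∈-image⁻ u′ i∈u′
                    m≡m′ = cross m m′ (trans (sym eq) eq′)
                in m , x∈p∧x≢y⇒x∈p-y ∈⊤ (λ { refl → differ (trans (sym eq) (trans eq′ (cong u′ (sym m≡m′)))) }) , eq)
      (λ i j m _ _ r s → trans r (sym s)))
    (∣⊤∖m∣<k m₀)))
  (subst (_≤ ∣ image u ∩ image u′ ∣) (∣⊤∣≡n K)
    (∣∣≤-by-matching (⊤ {K}) (image u ∩ image u′) (λ m i → i ≡ u (punchIn m₀ m))
      (λ m _ → u (punchIn m₀ m) ,
        x∈p∩q⁺ (∈-image⁺ u _ , subst (_∈ image u′) (sym (agree _ (Fin.punchInᵢ≢i m₀ m))) (∈-image⁺ u′ _)) , refl)
      (λ m m′ i _ _ r s → Fin.punchIn-injective m₀ m m′ (inj _ _ (trans (sym r) s)))))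

-- The simulation

rot : Fin 3 → Fin 3
rot zero             = suc zero
rot (suc zero)       = suc (suc zero)
rot (suc (suc zero)) = zero

rot≢ : ∀ x → rot x ≢ x
rot≢ zero ()
rot≢ (suc zero) ()
rot≢ (suc (suc zero)) ()

rot²≢ : ∀ x → rot (rot x) ≢ x
rot²≢ zero ()
rot²≢ (suc zero) ()
rot²≢ (suc (suc zero)) ()

rot-compare : ∀ x y → x ≢ y → y ≡ rot x ⊎ x ≡ rot y
rot-compare zero zero neq = contradiction refl neq
rot-compare zero (suc zero) neq = inj₁ refl
rot-compare zero (suc (suc zero)) neq = inj₂ refl
rot-compare (suc zero) zero neq = inj₂ refl
rot-compare (suc zero) (suc zero) neq = contradiction refl neq
rot-compare (suc zero) (suc (suc zero)) neq = inj₁ refl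
rot-compare (suc (suc zero)) zero neq = inj₁ refl
rot-compare (suc (suc zero)) (suc zero) neq = inj₂ refl
rot-compare (suc (suc zero)) (suc (suc zero)) neq = contradiction refl neq

phase : ℕ → Fin 3
phase zero    = zero
phase (suc w) = rot (phase w)

-- The variable that displays block b itself.
owner : ℕ → ℕ
owner 0 = 0
owner 1 = 1
owner (suc (suc b)) = suc (suc (suc (owner b)))

form-owner : ∀ b (f : ℕ → ℕ) → form (owner b) f ≡ f b
form-owner 0 f = refl
form-owner 1 f = refl
form-owner (suc (suc b)) f = form-owner b (λ b → f (suc (suc b)))

-- The extra `suc` records that an owner is followed by the checksum of its triple; `owner≢last`
-- concludes that it is not the last variable.
owner-bound : ∀ t b → b < t * 2 → suc (owner b) < t * 3
owner-bound (suc t) 0 _ = s≤s (s≤s z≤n)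
owner-bound (suc t) 1 _ = s≤s (s≤s (s≤s z≤n))
owner-bound (suc t) (suc (suc b)) (s≤s (s≤s b<)) = s≤s (s≤s (s≤s (owner-bound t b b<)))

owner-first : ∀ i → owner (i * 2) ≡ i * 3
owner-first zero    = refl
owner-first (suc i) = cong (3 +_) (owner-first i)

owner-second : ∀ i → owner (suc (i * 2)) ≡ suc (i * 3)
owner-second zero    = refl
owner-second (suc i) = cong (3 +_) (owner-second i)

halve : ∀ t b → b < t * 2 → ∃ λ i → i < t × (b ≡ i * 2 ⊎ b ≡ suc (i * 2))
halve (suc t) 0 _ = 0 , z<s , inj₁ refl
halve (suc t) 1 _ = 0 , z<s , inj₂ refl
halve (suc t) (suc (suc b)) (s≤s (s≤s b<)) with halve t b b<
... | i , i<t , inj₁ eq = suc i , s≤s i<t , inj₁ (cong (2 +_) eq)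
... | i , i<t , inj₂ eq = suc i , s≤s i<t , inj₂ (cong (2 +_) eq)

-- Times, tags and configurations

module Construction (K t d Q : ℕ) .{{_ : NonZero d}} .{{_ : NonZero Q}}
  (1≤K : 1 ≤ K) (3t≤k : t * 3 ≤ suc K) where

  open Positional Q

  k E M : ℕ
  k = suc K
  E = t * 2 * d
  M = Q ^ E

  -- Coordinate c of the vector shown by variable m. Variables from `t * 3` on see only positions
  -- beyond the E digits, which are zero at times below M.
  content : ℕ → ℕ → ℕ → ℕ
  content m w c = form m (λ b → digit w (b * d + c))

  left right : ℕ → ℕ → ℕ → ℕ
  left  i w c = digit w (i * 2 * d + c)
  right i w c = digit w (suc (i * 2) * d + c)

  norm inner : ℕ → ℕ → ℕ
  norm  i w = ∑< d (λ c → right i w c * right i w c)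
  inner i w = ∑< d (λ c → left i w c * right i w c)

  infix 4 _∼_ _≈[_]_ _≐[_]_

  -- Equality of tags, kept as a relation between times so that the simulation precedes any finite
  -- encoding; `tagCode-injective` connects the two.
  record _∼_ (w w′ : ℕ) : Set where
    field
      norm≡  : ∀ i → i < t → norm i w ≡ norm i w′
      inner≡ : ∀ i → i < t → inner i w ≡ inner i w′
      carry≡ : carry E w ≡ carry E w′
      phase≡ : phase w ≡ phase w′
  open _∼_

  ∼-refl : ∀ {w} → w ∼ w
  ∼-refl = record { norm≡ = λ _ _ → refl ; inner≡ = λ _ _ → refl ; carry≡ = refl ; phase≡ = refl }

  ∼-sym : ∀ {w w′} → w ∼ w′ → w′ ∼ w
  ∼-sym p = record { norm≡ = λ i l → sym (norm≡ p i l) ; inner≡ = λ i l → sym (inner≡ p i l)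
                   ; carry≡ = sym (carry≡ p) ; phase≡ = sym (phase≡ p) }

  ∼-trans : ∀ {w w′ w″} → w ∼ w′ → w′ ∼ w″ → w ∼ w″
  ∼-trans p q = record { norm≡ = λ i l → trans (norm≡ p i l) (norm≡ q i l)
                       ; inner≡ = λ i l → trans (inner≡ p i l) (inner≡ q i l)
                       ; carry≡ = trans (carry≡ p) (carry≡ q) ; phase≡ = trans (phase≡ p) (phase≡ q) }

  record _≐[_]_ (w : ℕ) (m : Fin k) (w′ : ℕ) : Set where
    field
      content≡ : ∀ c → c < d → content (toℕ m) w c ≡ content (toℕ m) w′ c
      tag≡     : w ∼ w′
  open _≐[_]_

  -- Equality of the vertices representing variable m at times w and w′.  The next content is left
  -- out, as storing it would square the number of vertices; advance recovers it from the carry.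
  record _≈[_]_ (w : ℕ) (m : Fin k) (w′ : ℕ) : Set where
    field
      now  : w ≐[ m ] w′
      next : suc w ∼ suc w′
  open _≈[_]_

  ≐-refl : ∀ {w m} → w ≐[ m ] w
  ≐-refl = record { content≡ = λ _ _ → refl ; tag≡ = ∼-refl }

  ≐-sym : ∀ {w m w′} → w ≐[ m ] w′ → w′ ≐[ m ] w
  ≐-sym p = record { content≡ = λ c l → sym (content≡ p c l) ; tag≡ = ∼-sym (tag≡ p) }

  ≈-refl : ∀ {w m} → w ≈[ m ] w
  ≈-refl = record { now = ≐-refl ; next = ∼-refl }

  ≈-sym : ∀ {w m w′} → w ≈[ m ] w′ → w′ ≈[ m ] w
  ≈-sym p = record { now = ≐-sym (now p) ; next = ∼-sym (next p) }

  -- The successor must be below M too, since a vertex also holds the tag of the next time.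
  Valid : ℕ → Set
  Valid w = suc w < M

  content-suc : ∀ m w c → Valid w →
    content m (suc w) c + form m (λ b → loss (carry E w) (b * d + c))
      ≡ content m w c + form m (λ b → gain (carry E w) (b * d + c))
  content-suc m w c v = trans (sym (form-+ m _ _))
    (trans (form-cong m (λ b → digit-suc E w v (b * d + c))) (form-+ m _ _))

  -- The carry position belongs to the tag, so both contents undergo the same gain and loss, and the
  -- loss cancels.
  advance : ∀ {w m w′} → Valid w → Valid w′ → w ≈[ m ] w′ → suc w ≐[ m ] suc w′
  advance {w} {m} {w′} v v′ p = record { content≡ = same ; tag≡ = next p }
    where
    μ : ℕ
    μ = toℕ m
    J≡ : carry E w ≡ carry E w′
    J≡ = carry≡ (tag≡ (now p))
    same : ∀ c → c < d → content μ (suc w) c ≡ content μ (suc w′) c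
    same c l = +-cancelʳ-≡ (form μ (λ b → loss (carry E w) (b * d + c))) _ _ (begin
      content μ (suc w) c + form μ (λ b → loss (carry E w) (b * d + c))
        ≡⟨ content-suc μ w c v ⟩
      content μ w c + form μ (λ b → gain (carry E w) (b * d + c))
        ≡⟨ cong₂ (λ x J → x + form μ (λ b → gain J (b * d + c))) (content≡ (now p) c l) J≡ ⟩
      content μ w′ c + form μ (λ b → gain (carry E w′) (b * d + c))
        ≡⟨ sym (content-suc μ w′ c v′) ⟩
      content μ (suc w′) c + form μ (λ b → loss (carry E w′) (b * d + c))
        ≡⟨ cong (λ J → content μ (suc w′) c + form μ (λ b → loss J (b * d + c))) (sym J≡) ⟩
      content μ (suc w′) c + form μ (λ b → loss (carry E w) (b * d + c)) ∎)
      where open ≡-Reasoning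

  last : Fin k
  last = fromℕ K

  ≢last⇒< : ∀ {m} → m ≢ last → m F.< last
  ≢last⇒< {m} neq = subst (toℕ m <_) (sym (Fin.toℕ-fromℕ K))
    (≤∧≢⇒< (≤-pred (Fin.toℕ<n m)) (λ eq → neq (Fin.toℕ-injective (trans eq (sym (Fin.toℕ-fromℕ K))))))

  -- During an update earlier variables may already be one step ahead of later ones.
  Linked : Fin k → ℕ → Fin k → ℕ → Set
  Linked m w₁ m′ w₂ = ∃ λ w → Valid w × (w ≈[ m ] w₁ ⊎ Valid (suc w) × suc w ≈[ m ] w₁) × w ≈[ m′ ] w₂

  -- The abstract counterpart of a k-element independent set. The times are mere representatives:
  -- only their classes under `≈` are visible in the graph.
  record Config : Set where
    field
      time   : Fin k → ℕ
      valid  : ∀ m → Valid (time m)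
      linked : ∀ m m′ → m F.< m′ → Linked m (time m) m′ (time m′)
  open Config public

  module _ (C : Config) where

    -- An update sweeps from variable 0 to `last`, so `last` keeps the old phase until the update is
    -- complete.
    φ : Fin 3
    φ = phase (time C last)

    -- The time of variable m once the update in progress is completed (or, if none is, the next one):
    -- variables in phase rot φ are already there.
    hat : Fin k → ℕ
    hat m with phase (time C m) Fin.≟ rot φ
    ... | yes _ = time C m
    ... | no  _ = suc (time C m)

    hat-new : ∀ m → phase (time C m) ≡ rot φ → hat m ≡ time C m
    hat-new m eq with phase (time C m) Fin.≟ rot φ
    ... | yes _  = refl
    ... | no neq = contradiction eq neq

    hat-old : ∀ m → phase (time C m) ≢ rot φ → hat m ≡ suc (time C m)
    hat-old m neq with phase (time C m) Fin.≟ rot φ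
    ... | yes eq = contradiction eq neq
    ... | no _   = refl

    -- A link to `last` shows every other variable to be level with it or one step ahead.
    phase-cases : ∀ m → phase (time C m) ≡ φ ⊎ phase (time C m) ≡ rot φ
    phase-cases m with m Fin.≟ last
    ... | yes refl = inj₁ refl
    ... | no neq with linked C m last (≢last⇒< neq)
    ...   | w , _ , inj₁ a , b       = inj₁ (trans (sym (phase≡ (tag≡ (now a)))) (phase≡ (tag≡ (now b))))
    ...   | w , _ , inj₂ (_ , a) , b = inj₂ (trans (sym (phase≡ (tag≡ (now a)))) (cong rot (phase≡ (tag≡ (now b)))))

    old⇒φ : ∀ m → phase (time C m) ≢ rot φ → phase (time C m) ≡ φ
    old⇒φ m neq with phase-cases m
    ... | inj₁ eq = eq
    ... | inj₂ eq = contradiction eq neq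

    -- Three phases suffice to tell from the tags which of two variables is ahead.
    hat-linked : ∀ m m′ → m F.< m′ → ∃ λ w → w ≐[ m ] hat m × w ≐[ m′ ] hat m′
    hat-linked m m′ m<m′ with phase (time C m) Fin.≟ rot φ | phase (time C m′) Fin.≟ rot φ | linked C m m′ m<m′
    ... | yes _ | yes _ | w , v , inj₁ a , b = w , now a , now b
    ... | yes p | no ¬q | w , v , inj₁ a , b =
      contradiction (trans (sym (phase≡ (tag≡ (now b)))) (trans (phase≡ (tag≡ (now a))) p)) ¬q
    ... | no ¬p | yes q | w , v , inj₁ a , b =
      contradiction (trans (sym (phase≡ (tag≡ (now a)))) (trans (phase≡ (tag≡ (now b))) q)) ¬p
    ... | no _  | no _  | w , v , inj₁ a , b =
      suc w , advance v (valid C m) a , advance v (valid C m′) b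
    ... | yes p | yes q | w , v , inj₂ (v′ , a) , b =
      contradiction (trans (cong rot (trans (sym q) (sym (phase≡ (tag≡ (now b)))))) (trans (phase≡ (tag≡ (now a))) p)) (rot≢ (rot φ))
    ... | yes _ | no _  | w , v , inj₂ (v′ , a) , b = suc w , now a , advance v (valid C m′) b
    ... | no ¬p | yes q | w , v , inj₂ (v′ , a) , b =
      contradiction (trans (cong rot (trans (sym q) (sym (phase≡ (tag≡ (now b)))))) (trans (phase≡ (tag≡ (now a))) (old⇒φ m ¬p))) (rot²≢ φ)
    ... | no ¬p | no ¬q | w , v , inj₂ (v′ , a) , b =
      contradiction (trans (cong rot (trans (sym (old⇒φ m′ ¬q)) (sym (phase≡ (tag≡ (now b)))))) (trans (phase≡ (tag≡ (now a))) (old⇒φ m ¬p))) (rot≢ φ)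

    -- The reading assembled from the variables that display single blocks.
    potential : ℕ
    potential = value E (λ j → digit (hat (owner (j / d) mod k)) j)

  -- Triples and their checksums

  toℕ-mod : ∀ {m} → m < k → toℕ (m mod k) ≡ m
  toℕ-mod {m} m<k = trans (Fin.toℕ-fromℕ< (m%n<n m k)) (m<n⇒m%n≡m m<k)

  split-index : ∀ j → j ≡ j / d * d + j % d
  split-index j = trans (m≡m%n+[m/n]*n j d) (+-comm (j % d) _)

  block<2t : ∀ {j} → j < E → j / d < t * 2
  block<2t = m<n*o⇒m/o<n

  owner<k : ∀ {b} → b < t * 2 → owner b < k
  owner<k {b} b< = <-≤-trans (<-trans (n<1+n _) (owner-bound t b b<)) 3t≤k

  owner≢last : ∀ {b} → b < t * 2 → owner b mod k ≢ last
  owner≢last {b} b< eq = <-irrefl (trans (sym (toℕ-mod (owner<k b<))) (trans (cong toℕ eq) (Fin.toℕ-fromℕ K)))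
    (≤-pred (<-≤-trans (owner-bound t b b<) 3t≤k))

  owner-content : ∀ {b} → b < t * 2 → ∀ w c → content (toℕ (owner b mod k)) w c ≡ digit w (b * d + c)
  owner-content {b} b< w c =
    trans (cong (λ m → content m w c) (toℕ-mod (owner<k b<))) (form-owner b _)

  owner-digit : ∀ {b w w′} → b < t * 2 → w ≐[ owner b mod k ] w′ → ∀ c → c < d → digit w (b * d + c) ≡ digit w′ (b * d + c)
  owner-digit {b} {w} {w′} b< p c c<d =
    trans (sym (owner-content b< w c)) (trans (content≡ p c c<d) (owner-content b< w′ c))

  digit-agree : ∀ {j w w′} → j < E → w ≐[ owner (j / d) mod k ] w′ → digit w j ≡ digit w′ j
  digit-agree {j} {w} {w′} j<E p =
    subst (λ x → digit w x ≡ digit w′ x) (sym (split-index j)) (owner-digit (block<2t j<E) p (j % d) (m%n<n j d))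

  module _ {i : ℕ} (i<t : i < t) where

    private
      bound : suc (suc (i * 3)) < k
      bound = ≤-trans (*-monoˡ-≤ 3 i<t) 3t≤k

    -- The variables of triple i: left block, right block, checksum.
    A B S : Fin k
    A = (i * 3) mod k
    B = suc (i * 3) mod k
    S = suc (suc (i * 3)) mod k

    toℕ-A : toℕ A ≡ i * 3
    toℕ-A = toℕ-mod (<-trans (n<1+n _) (<-trans (n<1+n _) bound))

    toℕ-B : toℕ B ≡ suc (i * 3)
    toℕ-B = toℕ-mod (<-trans (n<1+n _) bound)

    toℕ-S : toℕ S ≡ suc (suc (i * 3))
    toℕ-S = toℕ-mod bound

    A<B : A F.< B
    A<B = subst₂ _<_ (sym toℕ-A) (sym toℕ-B) (n<1+n _)

    B<S : B F.< S
    B<S = subst₂ _<_ (sym toℕ-B) (sym toℕ-S) (n<1+n _)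

    content-A : ∀ w c → content (toℕ A) w c ≡ left i w c
    content-A w c = trans (cong (λ m → content m w c) toℕ-A) (form-first i _)

    content-B : ∀ w c → content (toℕ B) w c ≡ right i w c
    content-B w c = trans (cong (λ m → content m w c) toℕ-B) (form-second i _)

    content-S : ∀ w c → content (toℕ S) w c ≡ left i w c + right i w c
    content-S w c = trans (cong (λ m → content m w c) toℕ-S) (form-sum i _)

    left-≐ : ∀ {w w′} → w ≐[ A ] w′ → ∀ c → c < d → left i w c ≡ left i w′ c
    left-≐ {w} {w′} p c l = trans (sym (content-A w c)) (trans (content≡ p c l) (content-A w′ c))

    right-≐ : ∀ {w w′} → w ≐[ B ] w′ → ∀ c → c < d → right i w c ≡ right i w′ c
    right-≐ {w} {w′} p c l = trans (sym (content-B w c)) (trans (content≡ p c l) (content-B w′ c))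

    sum-≐ : ∀ {w w′} → w ≐[ S ] w′ → ∀ c → c < d → left i w c + right i w c ≡ left i w′ c + right i w′ c
    sum-≐ {w} {w′} p c l = trans (sym (content-S w c)) (trans (content≡ p c l) (content-S w′ c))

    -- The links of A with B, A with S and B with S give times x, y, z that need not coincide. Left
    -- blocks agree at x and y, right blocks at x and z, sums at y and z, and all tags agree;
    -- `checksum-rigid` then makes the right blocks at x and y equal, so S at y shows the sum of
    -- what A and B show.
    checksum : ∀ C c → c < d →
      left i (hat C S) c + right i (hat C S) c ≡ left i (hat C A) c + right i (hat C B) c
    checksum C c l with hat-linked C A B A<B | hat-linked C A S (<-trans A<B B<S) | hat-linked C B S B<S
    ... | x , xA , xB | y , yA , yS | z , zB , zS = begin
      left i (hat C S) c + right i (hat C S) c   ≡⟨ sym (sum-≐ yS c l) ⟩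
      left i y c + right i y c                   ≡⟨ cong₂ _+_ (left-≐ yA c l) (sym (q≡q′ c l)) ⟩
      left i (hat C A) c + right i x c           ≡⟨ cong (left i (hat C A) c +_) (right-≐ xB c l) ⟩
      left i (hat C A) c + right i (hat C B) c   ∎
      where
      open ≡-Reasoning
      xy : ∀ c → c < d → left i x c ≡ left i y c
      xy c l = trans (left-≐ xA c l) (sym (left-≐ yA c l))
      xz : ∀ c → c < d → right i x c ≡ right i z c
      xz c l = trans (right-≐ xB c l) (sym (right-≐ zB c l))
      yz : ∀ c → c < d → left i y c + right i y c ≡ left i z c + right i z c
      yz c l = trans (sum-≐ yS c l) (sym (sum-≐ zS c l))
      x∼y : x ∼ y
      x∼y = ∼-trans (tag≡ xA) (∼-sym (tag≡ yA))
      x∼z : x ∼ z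
      x∼z = ∼-trans (tag≡ xB) (∼-sym (tag≡ zB))
      q≡q′ : ∀ c → c < d → right i x c ≡ right i y c
      q≡q′ = checksum-rigid d (left i x) (right i x) (left i z) (right i y)
        (λ c l → trans (cong (_+ right i y c) (xy c l)) (trans (yz c l) (cong (left i z c +_) (sym (xz c l)))))
        (norm≡ x∼y i i<t)
        (trans (inner≡ x∼z i i<t) (∑<-cong d (λ c l → cong (left i z c *_) (sym (xz c l)))))

  -- At most one variable changes, phrased through pairs so that the changing variable need not be
  -- named.
  OneOff : Config → Config → Set
  OneOff C C′ = ∀ m m′ → m ≢ m′ → time C m ≈[ m ] time C′ m ⊎ time C m′ ≈[ m′ ] time C′ m′

  hat-agree : ∀ C C′ → φ C ≡ φ C′ → ∀ m → time C m ≈[ m ] time C′ m → hat C m ≐[ m ] hat C′ m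
  hat-agree C C′ φ≡ m p with phase (time C m) Fin.≟ rot (φ C) | phase (time C′ m) Fin.≟ rot (φ C′)
  ... | yes _ | yes _ = now p
  ... | yes x | no ¬y = contradiction (trans (sym (phase≡ (tag≡ (now p)))) (trans x (cong rot φ≡))) ¬y
  ... | no ¬x | yes y = contradiction (trans (phase≡ (tag≡ (now p))) (trans y (cong rot (sym φ≡)))) ¬x
  ... | no _  | no _  = advance (valid C m) (valid C′ m) p

  -- Of A, B and S at most one changes. A block either has an unchanged owner or is the difference
  -- of an unchanged checksum and the unchanged other block.
  potential-same-phase : ∀ C C′ → φ C ≡ φ C′ → OneOff C C′ → potential C ≡ potential C′
  potential-same-phase C C′ φ≡ off = value-cong E λ j j<E →
    subst (λ x → digit (hat C (owner (j / d) mod k)) x ≡ digit (hat C′ (owner (j / d) mod k)) x) (sym (split-index j))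
      (block (j / d) (block<2t j<E) (j % d) (m%n<n j d))
    where
    same : ∀ m m′ → m ≢ m′ → hat C m ≐[ m ] hat C′ m ⊎ hat C m′ ≐[ m′ ] hat C′ m′
    same m m′ m≢m′ with off m m′ m≢m′
    ... | inj₁ p = inj₁ (hat-agree C C′ φ≡ m p)
    ... | inj₂ p = inj₂ (hat-agree C C′ φ≡ m′ p)
    block : ∀ b → b < t * 2 → ∀ c → c < d →
      digit (hat C (owner b mod k)) (b * d + c) ≡ digit (hat C′ (owner b mod k)) (b * d + c)
    block b b< c c<d with halve t b b<
    ... | i , i<t , inj₁ refl rewrite owner-first i
        with same (A i<t) (B i<t) (Fin.<⇒≢ (A<B i<t)) | same (A i<t) (S i<t) (Fin.<⇒≢ (<-trans (A<B i<t) (B<S i<t)))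
    ...   | inj₁ a | _      = left-≐ i<t a c c<d
    ...   | inj₂ _ | inj₁ a = left-≐ i<t a c c<d
    ...   | inj₂ b | inj₂ s = +-cancelʳ-≡ (right i (hat C (B i<t)) c) _ _
      (trans (sym (checksum i<t C c c<d)) (trans (sum-≐ i<t s c c<d) (trans (checksum i<t C′ c c<d)
        (cong (left i (hat C′ (A i<t)) c +_) (sym (right-≐ i<t b c c<d))))))
    block b b< c c<d | i , i<t , inj₂ refl rewrite owner-second i
        with same (A i<t) (B i<t) (Fin.<⇒≢ (A<B i<t)) | same (B i<t) (S i<t) (Fin.<⇒≢ (B<S i<t))
    ...   | inj₂ b | _      = right-≐ i<t b c c<d
    ...   | inj₁ _ | inj₁ b = right-≐ i<t b c c<d
    ...   | inj₁ a | inj₂ s = +-cancelˡ-≡ (left i (hat C (A i<t)) c) _ _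
      (trans (sym (checksum i<t C c c<d)) (trans (sum-≐ i<t s c c<d) (trans (checksum i<t C′ c c<d)
        (cong (_+ right i (hat C′ (B i<t)) c) (sym (left-≐ i<t a c c<d))))))

  -- The phase of `last` changes, so every other variable stays. Being compatible with both phases,
  -- these variables are all in phase `rot (φ C)`: the update is complete in C and the next one is
  -- about to begin in C′. Hence `hat` moves from their time to its successor, with one common carry
  -- position.
  potential-next-phase : ∀ C C′ → φ C′ ≡ rot (φ C) → OneOff C C′ → potential C′ ≡ suc (potential C)
  potential-next-phase C C′ φ′≡ off = value-suc E J J<E (λ j _ → digit<Q _ j) step
    where
    same : ∀ m → m ≢ last → time C m ≈[ m ] time C′ m
    same m m≢last with off m last m≢last
    ... | inj₁ p = p
    ... | inj₂ p = contradiction (trans (sym φ′≡) (sym (phase≡ (tag≡ (now p))))) (rot≢ (φ C))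
    new : ∀ m → m ≢ last → phase (time C m) ≡ rot (φ C)
    new m m≢last with phase-cases C m | phase-cases C′ m
    ... | inj₂ eq | _       = eq
    ... | inj₁ _  | inj₁ eq = trans (phase≡ (tag≡ (now (same m m≢last)))) (trans eq φ′≡)
    -- The phase of m would be both `φ C` and `rot (rot (φ C))`.
    ... | inj₁ eq | inj₂ eq′ = contradiction
      (trans (sym (trans eq′ (cong rot φ′≡))) (trans (sym (phase≡ (tag≡ (now (same m m≢last))))) eq)) (rot²≢ (φ C))
    hat≡ : ∀ m → m ≢ last → hat C m ≡ time C m
    hat≡ m m≢last = hat-new C m (new m m≢last)
    hat′≡ : ∀ m → m ≢ last → hat C′ m ≡ suc (time C′ m)
    hat′≡ m m≢last = hat-old C′ m λ eq → rot≢ (rot (φ C))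
      (trans (cong rot (sym φ′≡)) (trans (sym eq) (trans (sym (phase≡ (tag≡ (now (same m m≢last))))) (new m m≢last))))
    -- Variable zero is the reference for the common carry position; it differs from `last` because
    -- k is at least 2.
    zero≢last : zero ≢ last
    zero≢last eq = <-irrefl (trans (cong toℕ eq) (Fin.toℕ-fromℕ K)) 1≤K
    J : ℕ
    J = carry E (time C zero)
    J<E : J < E
    J<E = carry<E E (time C zero) (valid C zero)
    J≡ : ∀ m → m ≢ last → carry E (time C m) ≡ J
    J≡ zero    _ = refl
    J≡ (suc m) m≢last with hat-linked C zero (suc m) z<s
    ... | w , a , b = subst₂ (λ x y → carry E x ≡ carry E y) (hat≡ (suc m) m≢last) (hat≡ zero zero≢last)
      (trans (sym (carry≡ (tag≡ b))) (carry≡ (tag≡ a)))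
    step : ∀ j → j < E →
      digit (hat C′ (owner (j / d) mod k)) j + loss J j ≡ digit (hat C (owner (j / d) mod k)) j + gain J j
    step j j<E = begin
      digit (hat C′ m) j + loss J j               ≡⟨ cong (λ w → digit w j + loss J j) (hat′≡ m m≢last) ⟩
      digit (suc (time C′ m)) j + loss J j        ≡⟨ cong (λ J → digit (suc (time C′ m)) j + loss J j) (sym J′≡) ⟩
      digit (suc (time C′ m)) j + loss (carry E (time C′ m)) j
                                                  ≡⟨ digit-suc E (time C′ m) (valid C′ m) j ⟩
      digit (time C′ m) j + gain (carry E (time C′ m)) j
                                                  ≡⟨ cong₂ (λ x J → x + gain J j) (sym (digit-agree j<E (now (same m m≢last)))) J′≡ ⟩
      digit (time C m) j + gain J j               ≡⟨ cong (λ w → digit w j + gain J j) (sym (hat≡ m m≢last)) ⟩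
      digit (hat C m) j + gain J j                ∎
      where
      open ≡-Reasoning
      m : Fin k
      m = owner (j / d) mod k
      m≢last : m ≢ last
      m≢last = owner≢last (block<2t j<E)
      J′≡ : carry E (time C′ m) ≡ J
      J′≡ = trans (sym (carry≡ (tag≡ (now (same m m≢last))))) (J≡ m m≢last)

  -- A changed phase is one rotation forwards or backwards; the backward case is the forward one
  -- with C and C′ exchanged.
  potential-Lipschitz : ∀ C C′ → OneOff C C′ → potential C′ ≤ suc (potential C)
  potential-Lipschitz C C′ off with φ C Fin.≟ φ C′
  ... | yes eq = m≤n⇒m≤1+n (≤-reflexive (sym (potential-same-phase C C′ eq off)))
  ... | no neq with rot-compare (φ C) (φ C′) neq
  ...   | inj₁ φ′≡ = ≤-reflexive (potential-next-phase C C′ φ′≡ off)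
  ...   | inj₂ φ≡  = m≤n⇒m≤1+n (≤-trans (n≤1+n _) (≤-reflexive (sym (potential-next-phase C′ C φ≡ off′))))
    where
    off′ : OneOff C′ C
    off′ m m′ m≢m′ with off m m′ m≢m′
    ... | inj₁ p = inj₁ (≈-sym p)
    ... | inj₂ p = inj₂ (≈-sym p)

  -- The graph

  -- `bound` exceeds every inner product of two vectors of d digits; `size` allows for a content and
  -- two tags, the present and the next.
  bound tagSize size : ℕ
  bound   = suc (d * (Q * Q))
  tagSize = bound ^ t * (bound ^ t * (suc E * 3))
  size    = (Q + Q) ^ d * (tagSize * tagSize)

  ∑-products<bound : ∀ (f g : ℕ → ℕ) → (∀ c → f c < Q) → (∀ c → g c < Q) → ∑< d (λ c → f c * g c) < bound
  ∑-products<bound f g f<Q g<Q = s≤s (∑<-≤ d (λ c → *-mono-≤ (<⇒≤ (f<Q c)) (<⇒≤ (g<Q c))))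

  left<Q : ∀ i w c → left i w c < Q
  left<Q i w c = digit<Q w (i * 2 * d + c)

  right<Q : ∀ i w c → right i w c < Q
  right<Q i w c = digit<Q w (suc (i * 2) * d + c)

  normCode innerCode : ℕ → Fin t → Fin bound
  normCode  w i = fromℕ< (∑-products<bound (right (toℕ i) w) (right (toℕ i) w) (right<Q (toℕ i) w) (right<Q (toℕ i) w))
  innerCode w i = fromℕ< (∑-products<bound (left (toℕ i) w) (right (toℕ i) w) (left<Q (toℕ i) w) (right<Q (toℕ i) w))

  carryCode : ℕ → Fin (suc E)
  carryCode w = fromℕ< (s≤s (carry≤E E w))

  tagCode : ℕ → Fin tagSize
  tagCode w = combine (funToFin (normCode w)) (combine (funToFin (innerCode w)) (combine (carryCode w) (phase w)))

  contentCode : Fin k → ℕ → Fin d → Fin (Q + Q)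
  contentCode m w c = fromℕ< (form-< (toℕ m) (λ b → digit<Q w (b * d + toℕ c)))

  fromFin : ∀ {a} {P : ℕ → Set} → (∀ (i : Fin a) → P (toℕ i)) → ∀ i → i < a → P i
  fromFin {P = P} p i i<a = subst P (Fin.toℕ-fromℕ< i<a) (p (fromℕ< i<a))

  tagCode-injective : ∀ w w′ → tagCode w ≡ tagCode w′ → w ∼ w′
  tagCode-injective w w′ eq with Fin.combine-injective _ _ _ _ eq
  ... | norms , rest with Fin.combine-injective _ _ _ _ rest
  ...   | inners , rest′ with Fin.combine-injective _ _ _ _ rest′
  ...     | carries , phases = record
    { norm≡  = fromFin (λ i → Fin.fromℕ<-injective _ _ _ _ (funToFin-injective (normCode w) (normCode w′) norms i))
    ; inner≡ = fromFin (λ i → Fin.fromℕ<-injective _ _ _ _ (funToFin-injective (innerCode w) (innerCode w′) inners i))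
    ; carry≡ = Fin.fromℕ<-injective _ _ _ _ carries
    ; phase≡ = phases }

  module Realisation {n : ℕ} (fits : k * size ≤ n) where

    -- From here on a code is known only through `code-variable` and `code-time`.
    abstract

      code : Fin k → ℕ → Fin n
      code m w = inject≤ (combine m (combine (funToFin (contentCode m w)) (combine (tagCode w) (tagCode (suc w))))) fits

      code-variable : ∀ m w m′ w′ → code m w ≡ code m′ w′ → m ≡ m′
      code-variable m w m′ w′ eq = Fin.combine-injectiveˡ m _ m′ _ (Fin.inject≤-injective fits fits _ _ eq)

      code-time : ∀ m w w′ → code m w ≡ code m w′ → w ≈[ m ] w′
      code-time m w w′ eq with Fin.combine-injective _ _ _ _ (Fin.combine-injectiveʳ m _ m _ (Fin.inject≤-injective fits fits _ _ eq))
      ... | contents , tags with Fin.combine-injective _ _ _ _ tags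
      ...   | tag , tag′ = record
        { now  = record
          { content≡ = fromFin (λ c → Fin.fromℕ<-injective _ _ _ _
              (funToFin-injective (contentCode m w) (contentCode m w′) contents c))
          ; tag≡ = tagCode-injective w w′ tag }
        ; next = tagCode-injective (suc w) (suc w′) tag′ }

    -- One common time w explains both vertices, the earlier variable being possibly one step ahead.
    -- The bound `w < M` makes the search in `Link?` finite.
    Link : Fin n → Fin n → Set
    Link i j = ∃ λ m → ∃ λ m′ → m F.< m′ × ∃ λ w → w < M × Valid w ×
      (i ≡ code m w ⊎ Valid (suc w) × i ≡ code m (suc w)) × j ≡ code m′ w

    Link? : ∀ i j → Dec (Link i j)
    Link? i j = Fin.any? λ m → Fin.any? λ m′ → (m Fin.<? m′) ×-dec
      anyUpTo? (λ w → (suc w <? M) ×-dec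
        (((i Fin.≟ code m w) ⊎-dec ((suc (suc w) <? M) ×-dec (i Fin.≟ code m (suc w)))) ×-dec (j Fin.≟ code m′ w))) M

    Compatible : Fin n → Fin n → Set
    Compatible i j = i ≡ j ⊎ Link i j ⊎ Link j i

    abstract

      Compatible? : ∀ i j → Dec (Compatible i j)
      Compatible? i j = (i Fin.≟ j) ⊎-dec (Link? i j ⊎-dec Link? j i)

    Compatible-sym : ∀ {i j} → Compatible i j → Compatible j i
    Compatible-sym (inj₁ eq) = inj₁ (sym eq)
    Compatible-sym (inj₂ l)  = inj₂ (swap l)

    -- Edges join incompatible vertices, so independent sets are the sets of pairwise compatible
    -- vertices.
    G : Graph n
    G = record
      { adj    = λ i j → not (does (Compatible? i j))
      ; sym    = λ i j → cong not (does-⇔ (mk⇔ Compatible-sym Compatible-sym) (Compatible? i j) (Compatible? j i))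
      ; irrefl = λ i → cong not (dec-true (Compatible? i i) (inj₁ refl)) }

    nonadjacent⇒compatible : ∀ i j → adj G i j ≡ false → Compatible i j
    nonadjacent⇒compatible i j = not-does (Compatible? i j)

    compatible⇒nonadjacent : ∀ i j → Compatible i j → adj G i j ≡ false
    compatible⇒nonadjacent i j c = cong not (dec-true (Compatible? i j) c)

    Coded : Fin n → Fin k → Set
    Coded i m = ∃ λ w → Valid w × i ≡ code m w

    -- From independent sets to configurations

    module Extract (I : Subset n) (ind : Independent G I) (∣I∣≡k : ∣ I ∣ ≡ k) where

      another : ∀ i → ∃ λ j → j ∈ I × j ≢ i
      another i with Fin.any? (λ j → (j ∈? I) ×-dec ¬? (j Fin.≟ i))
      ... | yes found = found
      ... | no  none  = contradiction
        (≤-trans (≤-reflexive (sym ∣I∣≡k)) (≤-trans (p⊆q⇒∣p∣≤∣q∣ I⊆⁅i⁆) (≤-reflexive (∣⁅x⁆∣≡1 i)))) (<⇒≱ (s≤s 1≤K))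
        where
        I⊆⁅i⁆ : I ⊆ ⁅ i ⁆
        I⊆⁅i⁆ {j} j∈I with j Fin.≟ i
        ... | yes refl = x∈⁅x⁆ i
        ... | no j≢i   = contradiction (j , j∈I , j≢i) none

      -- A vertex outside the code is compatible only with itself, so it lies in no independent set
      -- with a second element. This disposes of the padding up to n vertices.
      coded : ∀ i → i ∈ I → ∃ λ m → Coded i m
      coded i i∈I with another i
      ... | j , j∈I , j≢i with nonadjacent⇒compatible i j (ind i j i∈I j∈I)
      ...   | inj₁ eq = contradiction (sym eq) j≢i
      ...   | inj₂ (inj₁ (m , _ , _ , w , _ , v , inj₁ eq , _))        = m , w , v , eq
      ...   | inj₂ (inj₁ (m , _ , _ , w , _ , v , inj₂ (v′ , eq) , _)) = m , suc w , v′ , eq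
      ...   | inj₂ (inj₂ (_ , m , _ , w , _ , v , _ , eq))             = m , w , v , eq

      link-variables : ∀ {i j m w m′ w′} → i ≡ code m w → j ≡ code m′ w′ → Link i j →
        m F.< m′ × Linked m w m′ w′
      link-variables {m = m} {w} {m′} {w′} refl refl (μ , μ′ , μ<μ′ , x , _ , v , inj₁ a , b)
        with code-variable m w μ x a | code-variable m′ w′ μ′ x b
      ... | refl | refl = μ<μ′ , x , v , inj₁ (≈-sym (code-time m w x a)) , ≈-sym (code-time m′ w′ x b)
      link-variables {m = m} {w} {m′} {w′} refl refl (μ , μ′ , μ<μ′ , x , _ , v , inj₂ (v′ , a) , b)
        with code-variable m w μ (suc x) a | code-variable m′ w′ μ′ x b
      ... | refl | refl = μ<μ′ , x , v , inj₂ (v′ , ≈-sym (code-time m w (suc x) a)) , ≈-sym (code-time m′ w′ x b)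

      -- A link joins two different variables, so distinct values of one variable are never
      -- compatible.
      unique : ∀ {i j m w w′} → i ∈ I → j ∈ I → i ≡ code m w → j ≡ code m w′ → i ≡ j
      unique {i} {j} i∈I j∈I p q with nonadjacent⇒compatible i j (ind i j i∈I j∈I)
      ... | inj₁ eq       = eq
      ... | inj₂ (inj₁ l) = contradiction (proj₁ (link-variables p q l)) (<-irrefl refl)
      ... | inj₂ (inj₂ l) = contradiction (proj₁ (link-variables q p l)) (<-irrefl refl)

      -- Pigeonhole: were m unoccupied, the k elements of I would be matched injectively with the k
      -- - 1 other variables.
      occupied : ∀ m → ∃ λ w → w < M × Valid w × code m w ∈ I
      occupied m with anyUpTo? (λ w → (suc w <? M) ×-dec (code m w ∈? I)) M
      ... | yes found = found
      ... | no  none  = contradiction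
        (subst (_≤ ∣ ⊤ ∖ m ∣) ∣I∣≡k
          (∣∣≤-by-matching I (⊤ ∖ m) Coded
            (λ i i∈I → let μ , w , v , eq = coded i i∈I in
              μ , x∈p∧x≢y⇒x∈p-y ∈⊤ (λ { refl → none (w , <-trans (n<1+n w) v , v , subst (_∈ I) eq i∈I) }) , w , v , eq)
            (λ { i j μ i∈I j∈I (_ , _ , p) (_ , _ , q) → unique i∈I j∈I p q })))
        (<⇒≱ (∣⊤∖m∣<k m))

      config : Config
      config = record
        { time   = λ m → proj₁ (occupied m)
        ; valid  = λ m → proj₁ (proj₂ (proj₂ (occupied m)))
        ; linked = link }
        where
        link : ∀ m m′ → m F.< m′ → Linked m (proj₁ (occupied m)) m′ (proj₁ (occupied m′))
        link m m′ m<m′ with occupied m | occupied m′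
        ... | w , _ , _ , ∈I | w′ , _ , _ , ∈I′ with nonadjacent⇒compatible _ _ (ind _ _ ∈I ∈I′)
        ...   | inj₁ eq       = contradiction (cong toℕ (code-variable m w m′ w′ eq)) (<⇒≢ m<m′)
        ...   | inj₂ (inj₁ l) = proj₂ (link-variables refl refl l)
        ...   | inj₂ (inj₂ l) = contradiction (proj₁ (link-variables {m = m′} {m′ = m} refl refl l)) (<-asym m<m′)

    Represents : Config → KIndSet G k → Set
    Represents C X = ∀ m → code m (time C m) ∈ proj₁ X

    represented : ∀ X → ∃ λ C → Represents C X
    represented (I , ind , size≡) = config , λ m → proj₂ (proj₂ (proj₂ (occupied m)))
      where open Extract I ind size≡

    -- The representing times are not canonical, but each variable has only one vertex in the set,
    -- so any two choices are `≈`.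
    potential-unique : ∀ X {C C′} → Represents C X → Represents C′ X → potential C ≡ potential C′
    potential-unique (I , ind , size≡) {C} {C′} r r′ =
      potential-same-phase C C′ (phase≡ (tag≡ (now (same last)))) (λ m _ _ → inj₁ (same m))
      where
      open Extract I ind size≡
      same : ∀ m → time C m ≈[ m ] time C′ m
      same m = code-time m _ _ (unique (r m) (r′ m) refl refl)

    -- If m and m′ both changed, neither would own an element of I ∩ J, and K elements would be
    -- matched with K - 1 variables.
    adjacent⇒OneOff : ∀ X Y {C C′} → Represents C X → Represents C′ Y → RAdj G k X Y → OneOff C C′
    adjacent⇒OneOff (I , indI , sizeI) (J , indJ , sizeJ) {C} {C′} r r′ ∣I∩J∣≡K m m′ m≢m′
      with code m (time C m) Fin.≟ code m (time C′ m) | code m′ (time C m′) Fin.≟ code m′ (time C′ m′)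
    ... | yes eq | _      = inj₁ (code-time m _ _ eq)
    ... | no _   | yes eq = inj₂ (code-time m′ _ _ eq)
    ... | no ¬p  | no ¬q  = contradiction
      (subst (_≤ ∣ (⊤ ∖ m) ∖ m′ ∣) ∣I∩J∣≡K
        (∣∣≤-by-matching (I ∩ J) ((⊤ ∖ m) ∖ m′) (λ i μ → i ≡ code μ (time C μ)) total (λ i j μ _ _ p q → trans p (sym q))))
      (<⇒≱ (≤-pred (∣⊤∖m∖m′∣<k∸1 m m′ (m≢m′ ∘ sym))))
      where
      module I = Extract I indI sizeI
      module J = Extract J indJ sizeJ
      total : ∀ i → i ∈ I ∩ J → ∃ λ μ → μ ∈ (⊤ ∖ m) ∖ m′ × i ≡ code μ (time C μ)
      total i i∈ with x∈p∩q⁻ I J i∈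
      ... | i∈I , i∈J with I.coded i i∈I
      ...   | μ , w , v , eq = μ ,
        x∈p∧x≢y⇒x∈p-y (x∈p∧x≢y⇒x∈p-y ∈⊤ (λ { refl → ¬p (trans (sym inI) inJ) })) (λ { refl → ¬q (trans (sym inI) inJ) }) ,
        inI
        where
        inI : i ≡ code μ (time C μ)
        inI = I.unique i∈I (r μ) eq refl
        inJ : i ≡ code μ (time C′ μ)
        inJ = J.unique i∈J (r′ μ) eq refl

    walk-length : ∀ {X Y ℓ C C′} → Represents C X → Represents C′ Y → Walk G k X Y ℓ → potential C′ ≤ ℓ + potential C
    walk-length {X} {C = C} {C′} r r′ nil = ≤-reflexive (potential-unique X {C′} {C} r′ r)
    walk-length {X} {C = C} {C′} r r′ (cons {Y = Y} {ℓ = ℓ} step walk) with represented Y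
    ... | D , rD = begin
      potential C′               ≤⟨ walk-length {C = D} {C′} rD r′ walk ⟩
      ℓ + potential D            ≤⟨ +-monoʳ-≤ ℓ (potential-Lipschitz C D (adjacent⇒OneOff X Y {C} {D} r rD step)) ⟩
      ℓ + suc (potential C)      ≡⟨ +-suc ℓ _ ⟩
      suc (ℓ + potential C)      ∎
      where open ≤-Reasoning

    -- The canonical walk: at stage j of update w the variables below j are at time w + 1.
    clock : ℕ → ℕ → Fin k → ℕ
    clock w j m with toℕ m <? j
    ... | yes _ = suc w
    ... | no  _ = w

    tokens : ℕ → ℕ → Fin k → Fin n
    tokens w j m = code m (clock w j m)

    tokens-linked : ∀ w j → Valid (suc w) → ∀ m m′ → m F.< m′ → Link (tokens w j m) (tokens w j m′)
    tokens-linked w j v m m′ m<m′ with toℕ m <? j | toℕ m′ <? j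
    ... | yes _   | yes _  = m , m′ , m<m′ , suc w , <-trans (n<1+n _) v , v , inj₁ refl , refl
    ... | yes _   | no _   = m , m′ , m<m′ , w , <-trans (n<1+n _) (<-trans (n<1+n _) v) , <-trans (n<1+n _) v , inj₂ (v , refl) , refl
    ... | no m≮j  | yes m′<j = contradiction (<-trans m<m′ m′<j) m≮j
    ... | no _    | no _   = m , m′ , m<m′ , w , <-trans (n<1+n _) (<-trans (n<1+n _) v) , <-trans (n<1+n _) v , inj₁ refl , refl

    tokens-compatible : ∀ w j → Valid (suc w) → ∀ m m′ → Compatible (tokens w j m) (tokens w j m′)
    tokens-compatible w j v m m′ with Fin.<-cmp m m′
    ... | tri< m<m′ _ _ = inj₂ (inj₁ (tokens-linked w j v m m′ m<m′))
    ... | tri≈ _ refl _ = inj₁ refl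
    ... | tri> _ _ m′<m = inj₂ (inj₂ (tokens-linked w j v m′ m m′<m))

    position : ∀ w j → Valid (suc w) → KIndSet G k
    position w j v = image (tokens w j) , independent , ∣image∣ (tokens w j) (λ m m′ → code-variable m _ m′ _)
      where
      independent : Independent G (image (tokens w j))
      independent i i′ i∈ i′∈ with ∈-image⁻ (tokens w j) i∈ | ∈-image⁻ (tokens w j) i′∈
      ... | m , refl | m′ , refl = compatible⇒nonadjacent _ _ (tokens-compatible w j v m m′)

    code-suc≢ : ∀ m w → code m w ≢ code m (suc w)
    code-suc≢ m w eq = rot≢ (phase w) (sym (phase≡ (tag≡ (now (code-time m w (suc w) eq)))))

    clock-yes : ∀ w j m → toℕ m < j → clock w j m ≡ suc w
    clock-yes w j m m<j with toℕ m <? j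
    ... | yes _  = refl
    ... | no m≮j = contradiction m<j m≮j

    clock-no : ∀ w j m → j ≤ toℕ m → clock w j m ≡ w
    clock-no w j m j≤m with toℕ m <? j
    ... | yes m<j = contradiction j≤m (<⇒≱ m<j)
    ... | no _    = refl

    step-inner : ∀ w j (v : Valid (suc w)) → j < K → RAdj G k (position w j v) (position w (suc j) v)
    step-inner w j v j<K = ∣image∩image∣ (tokens w j) (tokens w (suc j)) m₀
      (λ m m′ → code-variable m _ m′ _) (λ m m′ → code-variable m _ m′ _) differ agree
      where
      j<k : j < k
      j<k = m<n⇒m<1+n j<K
      m₀ : Fin k
      m₀ = fromℕ< j<k
      toℕ-m₀ : toℕ m₀ ≡ j
      toℕ-m₀ = Fin.toℕ-fromℕ< j<k
      differ : tokens w j m₀ ≢ tokens w (suc j) m₀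
      differ eq = code-suc≢ m₀ w (subst₂ (λ x y → code m₀ x ≡ code m₀ y)
        (clock-no w j m₀ (≤-reflexive (sym toℕ-m₀))) (clock-yes w (suc j) m₀ (s≤s (≤-reflexive toℕ-m₀))) eq)
      agree : ∀ m → m ≢ m₀ → tokens w j m ≡ tokens w (suc j) m
      agree m m≢m₀ with <-cmp (toℕ m) j
      ... | tri< m<j _ _ = cong (code m) (trans (clock-yes w j m m<j) (sym (clock-yes w (suc j) m (m<n⇒m<1+n m<j))))
      ... | tri≈ _ m≡j _ = contradiction (Fin.toℕ-injective (trans m≡j (sym toℕ-m₀))) m≢m₀
      ... | tri> _ _ j<m = cong (code m) (trans (clock-no w j m (<⇒≤ j<m)) (sym (clock-no w (suc j) m j<m)))

    -- Moving `last` completes update w, and the result is stage 0 of update w + 1.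
    step-outer : ∀ w (v : Valid (suc w)) (v′ : Valid (suc (suc w))) → RAdj G k (position w K v) (position (suc w) 0 v′)
    step-outer w v v′ = ∣image∩image∣ (tokens w K) (tokens (suc w) 0) last
      (λ m m′ → code-variable m _ m′ _) (λ m m′ → code-variable m _ m′ _) differ agree
      where
      differ : tokens w K last ≢ tokens (suc w) 0 last
      differ eq = code-suc≢ last w (subst₂ (λ x y → code last x ≡ code last y)
        (clock-no w K last (≤-reflexive (sym (Fin.toℕ-fromℕ K)))) (clock-no (suc w) 0 last z≤n) eq)
      agree : ∀ m → m ≢ last → tokens w K m ≡ tokens (suc w) 0 m
      agree m m≢last = cong (code m) (trans
        (clock-yes w K m (subst (toℕ m <_) (Fin.toℕ-fromℕ K) (≢last⇒< m≢last)))
        (sym (clock-no (suc w) 0 m z≤n)))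

    snoc : ∀ {X Y Z ℓ} → Walk G k X Y ℓ → RAdj G k Y Z → Walk G k X Z (suc ℓ)
    snoc nil         r = cons r nil
    snoc (cons p ps) r = cons p (snoc ps r)

    walk-to : ∀ w j (v₀ : Valid 1) (v : Valid (suc w)) → j ≤ K → ∃ λ ℓ → Walk G k (position 0 0 v₀) (position w j v) ℓ
    walk-to zero zero v₀ v _ with <-irrelevant v₀ v
    ... | refl = 0 , nil
    walk-to (suc w) zero v₀ v _ =
      let v′ = <-trans (n<1+n _) v
          ℓ , walk = walk-to w K v₀ v′ ≤-refl in
      suc ℓ , snoc walk (step-outer w v′ v)
    walk-to w (suc j) v₀ v j<K =
      let ℓ , walk = walk-to w j v₀ v (<⇒≤ j<K) in suc ℓ , snoc walk (step-inner w j v j<K)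

    resting : ∀ w → Valid w → Config
    resting w v = record
      { time = λ _ → w ; valid = λ _ → v ; linked = λ _ _ _ → w , v , inj₁ ≈-refl , ≈-refl }

    resting-represents : ∀ w (v : Valid (suc w)) → Represents (resting w (<-trans (n<1+n _) v)) (position w 0 v)
    resting-represents w v m =
      subst (λ x → code m x ∈ image (tokens w 0)) (clock-no w 0 m z≤n) (∈-image⁺ (tokens w 0) m)

    -- At rest no variable is in phase `rot φ`, so `hat` reads the time after the next update. The
    -- offset by one cancels in `far-apart`.
    resting-potential : ∀ w (v : Valid w) → potential (resting w v) ≡ suc w
    resting-potential w v = trans
      (value-cong E (λ j _ → cong (λ x → digit x j)
        (hat-old (resting w v) (owner (j / d) mod k) (λ eq → rot≢ (phase w) (sym eq)))))
      (value-digit E (suc w) v)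

    far-apart : ∀ w → Valid (suc w) → (P : ℕ → Set) → (∀ ℓ → w ≤ ℓ → P ℓ) → HasPairAtDistance G k P
    far-apart w v P p = position 0 0 v₀ , position w 0 v , walk-to w 0 v₀ v z≤n , λ ℓ walk → p ℓ (far ℓ walk)
      where
      v₀ : Valid 1
      v₀ = ≤-<-trans (s≤s (s≤s z≤n)) v
      v⁻ : Valid w
      v⁻ = <-trans (n<1+n _) v
      v₀⁻ : Valid 0
      v₀⁻ = <-trans (n<1+n _) v₀
      far : ∀ ℓ → Walk G k (position 0 0 v₀) (position w 0 v) ℓ → w ≤ ℓ
      far ℓ walk = ≤-pred (subst₂ _≤_ (resting-potential w v⁻)
        (trans (cong (ℓ +_) (resting-potential 0 v₀⁻)) (+-comm ℓ 1))
        (walk-length {C = resting 0 v₀⁻} {resting w v⁻} (resting-represents 0 v₀) (resting-represents w v) walk))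

-- Choice of parameters

n<2^n : ∀ n → n < 2 ^ n
n<2^n zero    = z<s
n<2^n (suc n) = begin-strict
  suc n               ≤⟨ n<2^n n ⟩
  2 ^ n               <⟨ m<m+n (2 ^ n) (m^n>0 2 n) ⟩
  2 ^ n + 2 ^ n       ≡⟨ cong (2 ^ n +_) (sym (+-identityʳ (2 ^ n))) ⟩
  2 ^ suc n           ∎
  where open ≤-Reasoning

n≤2^⌈log₂n⌉ : ∀ n → n ≤ 2 ^ ⌈log₂ n ⌉
n≤2^⌈log₂n⌉ = <-rec (λ n → n ≤ 2 ^ ⌈log₂ n ⌉) go
  where
  go : ∀ n → (∀ {m} → m < n → m ≤ 2 ^ ⌈log₂ m ⌉) → n ≤ 2 ^ ⌈log₂ n ⌉
  go 0 _ = z≤n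
  go 1 _ = m^n>0 2 ⌈log₂ 1 ⌉
  go n@(suc (suc n′)) rec = begin
    n                                  ≡⟨ sym (⌊n/2⌋+⌈n/2⌉≡n n) ⟩
    ⌊ n /2⌋ + ⌈ n /2⌉                  ≤⟨ +-monoˡ-≤ ⌈ n /2⌉ (⌊n/2⌋≤⌈n/2⌉ n) ⟩
    ⌈ n /2⌉ + ⌈ n /2⌉                  ≡⟨ cong (⌈ n /2⌉ +_) (sym (+-identityʳ ⌈ n /2⌉)) ⟩
    2 * ⌈ n /2⌉                        ≤⟨ *-monoʳ-≤ 2 (rec (⌈n/2⌉<n n′)) ⟩
    2 * 2 ^ ⌈log₂ ⌈ n /2⌉ ⌉            ≡⟨ cong (λ e → 2 * 2 ^ e) (⌈log₂⌈n/2⌉⌉≡⌈log₂n⌉∸1 n) ⟩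
    2 ^ suc (⌈log₂ n ⌉ ∸ 1)            ≡⟨ cong (2 ^_) (m+[n∸m]≡n 1≤log) ⟩
    2 ^ ⌈log₂ n ⌉                      ∎
    where
    open ≤-Reasoning
    1≤log : 1 ≤ ⌈log₂ n ⌉
    1≤log = subst (_≤ ⌈log₂ n ⌉) (⌈log₂2^n⌉≡n 1) (⌈log₂⌉-mono-≤ {2} {n} (s≤s (s≤s z≤n)))

a<⌈log₂n⌉⇒2^a<n : ∀ {a n} → a < ⌈log₂ n ⌉ → 2 ^ a < n
a<⌈log₂n⌉⇒2^a<n {a} {n} a<log = ≰⇒> λ n≤2^a →
  <⇒≱ a<log (subst (⌈log₂ n ⌉ ≤_) (⌈log₂2^n⌉≡n a) (⌈log₂⌉-mono-≤ n≤2^a))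

-- The given s may lie far above √(log n), whereas the parameters must fit n; minimality of s′
-- yields (s′ - 1)² < L ≤ s′².
least-square-root : ∀ L s → L ≤ s * s → ∃ λ s′ → s′ ≤ s × L ≤ s′ * s′ × (∀ r → suc r ≡ s′ → r * r < L)
least-square-root L zero    L≤ = 0 , z≤n , L≤ , λ _ ()
least-square-root L (suc s) L≤ with s * s <? L
... | yes lt = suc s , ≤-refl , L≤ , λ { r refl → lt }
... | no ≮L  = let s′ , s′≤s , rest = least-square-root L s (≮⇒≥ ≮L) in s′ , m≤n⇒m≤1+n s′≤s , rest

square-cancel-≤ : ∀ {a b} → a * a ≤ b * b → a ≤ b
square-cancel-≤ a²≤b² = ≮⇒≥ λ b<a → <⇒≱ (*-mono-< b<a b<a) a²≤b²

-- With d = x digits in base Q = 2 ^ x the vertices number at most 2 ^ (x² + O(x)).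
module Sizes (K t x : ℕ) .{{_ : NonZero x}} (1≤K : 1 ≤ K) (3t≤k : t * 3 ≤ suc K) where

  instance
    2^x≢0 : NonZero (2 ^ x)
    2^x≢0 = m^n≢0 2 x

  open Construction K t x (2 ^ x) 1≤K 3t≤k public

  bound≤ : bound ≤ 2 ^ (x + (x + x))
  bound≤ = begin
    suc (x * (2 ^ x * 2 ^ x))        ≤⟨ +-monoˡ-≤ (x * (2 ^ x * 2 ^ x)) (*-mono-≤ (m^n>0 2 x) (m^n>0 2 x)) ⟩
    suc x * (2 ^ x * 2 ^ x)          ≤⟨ *-monoˡ-≤ (2 ^ x * 2 ^ x) (n<2^n x) ⟩
    2 ^ x * (2 ^ x * 2 ^ x)          ≡⟨ cong (2 ^ x *_) (sym (^-distribˡ-+-* 2 x x)) ⟩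
    2 ^ x * 2 ^ (x + x)              ≡⟨ sym (^-distribˡ-+-* 2 x (x + x)) ⟩
    2 ^ (x + (x + x))                ∎
    where open ≤-Reasoning

  bound^t≤ : bound ^ t ≤ 2 ^ ((x + (x + x)) * t)
  bound^t≤ = subst (bound ^ t ≤_) (^-*-assoc 2 (x + (x + x)) t) (^-monoˡ-≤ t bound≤)

  tagExponent : ℕ
  tagExponent = (x + (x + x)) * t + ((x + (x + x)) * t + (E + 2))

  tagSize≤ : tagSize ≤ 2 ^ tagExponent
  tagSize≤ = begin
    bound ^ t * (bound ^ t * (suc E * 3))
      ≤⟨ *-mono-≤ bound^t≤ (*-mono-≤ bound^t≤ (*-mono-≤ (n<2^n E) (n≤1+n 3))) ⟩
    2 ^ e * (2 ^ e * (2 ^ E * 2 ^ 2))    ≡⟨ cong (λ y → 2 ^ e * (2 ^ e * y)) (sym (^-distribˡ-+-* 2 E 2)) ⟩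
    2 ^ e * (2 ^ e * 2 ^ (E + 2))        ≡⟨ cong (2 ^ e *_) (sym (^-distribˡ-+-* 2 e (E + 2))) ⟩
    2 ^ e * 2 ^ (e + (E + 2))            ≡⟨ sym (^-distribˡ-+-* 2 e (e + (E + 2))) ⟩
    2 ^ tagExponent                      ∎
    where
    open ≤-Reasoning
    e : ℕ
    e = (x + (x + x)) * t

  vertices≤ : k * size ≤ 2 ^ (k + (suc x * x + (tagExponent + tagExponent)))
  vertices≤ = begin
    k * ((2 ^ x + 2 ^ x) ^ x * (tagSize * tagSize))
      ≤⟨ *-mono-≤ (<⇒≤ (n<2^n k)) (*-mono-≤ (≤-reflexive content-size) (*-mono-≤ tagSize≤ tagSize≤)) ⟩
    2 ^ k * (2 ^ (suc x * x) * (2 ^ tagExponent * 2 ^ tagExponent))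
      ≡⟨ cong (λ y → 2 ^ k * (2 ^ (suc x * x) * y)) (sym (^-distribˡ-+-* 2 tagExponent tagExponent)) ⟩
    2 ^ k * (2 ^ (suc x * x) * 2 ^ (tagExponent + tagExponent))
      ≡⟨ cong (2 ^ k *_) (sym (^-distribˡ-+-* 2 (suc x * x) _)) ⟩
    2 ^ k * 2 ^ (suc x * x + (tagExponent + tagExponent))
      ≡⟨ sym (^-distribˡ-+-* 2 k _) ⟩
    2 ^ (k + (suc x * x + (tagExponent + tagExponent))) ∎
    where
    open ≤-Reasoning
    content-size : (2 ^ x + 2 ^ x) ^ x ≡ 2 ^ (suc x * x)
    content-size = trans (cong (λ y → (2 ^ x + y) ^ x) (sym (+-identityʳ (2 ^ x)))) (^-*-assoc 2 (suc x) x)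

-- The left side is x² + (16t + 1)x plus a constant, so it is absorbed by a square whose shift
-- exceeds 8t. The bracket added in `identity` is the slack.
exponent-bound : ∀ k t x → let e = (x + (x + x)) * t + ((x + (x + x)) * t + (t * 2 * x + 2)) in
  k + (suc x * x + (e + e)) ≤ (8 * t + k + 4 + x) * (8 * t + k + 4 + x)
exponent-bound k t x = m+n≤o⇒m≤o _ (≤-reflexive (identity k t x))
  where
  identity : ∀ k t x →
    k + (suc x * x + (((x + (x + x)) * t + ((x + (x + x)) * t + (t * 2 * x + 2))) + ((x + (x + x)) * t + ((x + (x + x)) * t + (t * 2 * x + 2)))))
      + (x * (2 * k + 7) + (8 * t + k) * (8 * t + k) + 64 * t + 7 * k + 12)
    ≡ (8 * t + k + 4 + x) * (8 * t + k + 4 + x)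
  identity = solve-∀

-- The odometer exponent `x * (t * 2 * x)` falls short of 2t(c + x)² only by a term linear in c + x,
-- that is, of order √(log n).
distance-exponent : ∀ t c x → (c + x) * (c + x) * (2 * t) ≤ x * (t * 2 * x) + 4 * t * c * (c + x)
distance-exponent t c x = m+n≤o⇒m≤o _ (≤-reflexive (identity t c x))
  where
  identity : ∀ t c x → (c + x) * (c + x) * (2 * t) + 2 * t * c * c ≡ x * (t * 2 * x) + 4 * t * c * (c + x)
  identity = solve-∀

module _ (K t : ℕ) (1≤t : 1 ≤ t) (1≤K : 1 ≤ K) (3t≤k : t * 3 ≤ suc K) where

  private
    -- `a` is the shift in `exponent-bound`; c = a + 1 makes a + x the predecessor of c + x; C is
    -- the coefficient in `distance-exponent`.
    a c C : ℕ
    a = 8 * t + suc K + 4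
    c = suc a
    C = 4 * t * c

  -- The lower bound on n makes room for the graph; the upper bound compares n^(2t) with the number
  -- M of readings.
  long-distance : ∀ x → 2 ≤ x → ∀ n s → 2 ^ ((a + x) * (a + x)) < n → n ≤ 2 ^ ((c + x) * (c + x)) → c + x ≤ s →
    Σ (Graph n) λ G → HasPairAtDistance G (suc K) (λ d → n ^ (2 * t) ≤ 4 * d * 2 ^ (C * s))
  long-distance x 2≤x n s 2^<n n≤2^ c+x≤s = G , far-apart (M ∸ 3) valid-end _ bounds
    where
    instance
      x≢0 : NonZero x
      x≢0 = >-nonZero (≤-trans (s≤s z≤n) 2≤x)
    open Sizes K t x 1≤K 3t≤k
    open Realisation (≤-trans vertices≤ (≤-trans (^-monoʳ-≤ 2 (exponent-bound (suc K) t x)) (<⇒≤ 2^<n)))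
    M≡ : M ≡ 2 ^ (x * E)
    M≡ = ^-*-assoc 2 x E
    4≤M : 4 ≤ M
    4≤M = subst (4 ≤_) (sym M≡) (^-monoʳ-≤ 2 (*-mono-≤ 2≤x (*-mono-≤ (*-mono-≤ 1≤t (s≤s (z≤n {1}))) (≤-trans (s≤s z≤n) 2≤x))))
    -- A position at stage 0 of update w asks for w + 3 ≤ M, so M - 3 is the latest possible w.
    valid-end : Valid (suc (M ∸ 3))
    valid-end = ≤-reflexive (m+[n∸m]≡n (≤-trans (n≤1+n 3) 4≤M))
    -- The source of the factor 4 in the bound; 4 ≤ M holds as x ≥ 2 and t ≥ 1.
    M≤4*[M∸3] : ∀ M → 4 ≤ M → M ≤ 4 * (M ∸ 3)
    M≤4*[M∸3] (suc (suc (suc (suc y)))) (s≤s (s≤s (s≤s (s≤s z≤n)))) =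
      subst (4 + y ≤_) (sym (*-distribˡ-+ 4 1 y)) (+-monoʳ-≤ 4 (m≤n*m y 4))
    open ≤-Reasoning
    bounds : ∀ ℓ → M ∸ 3 ≤ ℓ → n ^ (2 * t) ≤ 4 * ℓ * 2 ^ (C * s)
    bounds ℓ M∸3≤ℓ = begin
      n ^ (2 * t)                               ≤⟨ ^-monoˡ-≤ (2 * t) n≤2^ ⟩
      (2 ^ ((c + x) * (c + x))) ^ (2 * t)       ≡⟨ ^-*-assoc 2 ((c + x) * (c + x)) (2 * t) ⟩
      2 ^ ((c + x) * (c + x) * (2 * t))         ≤⟨ ^-monoʳ-≤ 2 (distance-exponent t c x) ⟩
      2 ^ (x * E + C * (c + x))                 ≤⟨ ^-monoʳ-≤ 2 (+-monoʳ-≤ (x * E) (*-monoʳ-≤ C c+x≤s)) ⟩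
      2 ^ (x * E + C * s)                       ≡⟨ ^-distribˡ-+-* 2 (x * E) (C * s) ⟩
      2 ^ (x * E) * 2 ^ (C * s)                 ≡⟨ cong (_* 2 ^ (C * s)) (sym M≡) ⟩
      M * 2 ^ (C * s)                           ≤⟨ *-monoˡ-≤ (2 ^ (C * s)) (≤-trans (M≤4*[M∸3] M 4≤M) (*-monoʳ-≤ 4 M∸3≤ℓ)) ⟩
      4 * ℓ * 2 ^ (C * s)                       ∎

  distance-lower-bound :
    Σ ℕ λ m → Σ ℕ λ C → 1 ≤ m × 1 ≤ C × Σ ℕ λ N →
      ∀ (n : ℕ) → N ≤ n → ∀ (s : ℕ) → ⌈log₂ n ⌉ ≤ s * s →
        Σ (Graph n) λ G → HasPairAtDistance G (suc K) (λ d → n ^ (2 * t) ≤ m * d * 2 ^ (C * s))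
  distance-lower-bound = 4 , C , s≤s z≤n , *-mono-≤ (*-mono-≤ {1} {4} (s≤s z≤n) 1≤t) (s≤s (z≤n {a})) ,
    -- This threshold forces s′ ≥ c + 2, hence x ≥ 2.
    2 ^ ((c + 2) * (c + 2)) , main
    where
    main : ∀ n → 2 ^ ((c + 2) * (c + 2)) ≤ n → ∀ s → ⌈log₂ n ⌉ ≤ s * s →
      Σ (Graph n) λ G → HasPairAtDistance G (suc K) (λ d → n ^ (2 * t) ≤ 4 * d * 2 ^ (C * s))
    main n N≤n s log≤ with least-square-root ⌈log₂ n ⌉ s log≤
    ... | s′ , s′≤s , log≤s′² , least = long-distance x 2≤x n s
      (a<⌈log₂n⌉⇒2^a<n (least (a + x) c+x≡s′))
      (≤-trans (n≤2^⌈log₂n⌉ n) (^-monoʳ-≤ 2 (subst (λ y → ⌈log₂ n ⌉ ≤ y * y) (sym c+x≡s′) log≤s′²)))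
      (≤-trans (≤-reflexive c+x≡s′) s′≤s)
      where
      c+2≤s′ : c + 2 ≤ s′
      c+2≤s′ = square-cancel-≤ (≤-trans
        (subst (_≤ ⌈log₂ n ⌉) (⌈log₂2^n⌉≡n ((c + 2) * (c + 2))) (⌈log₂⌉-mono-≤ N≤n)) log≤s′²)
      x : ℕ
      x = s′ ∸ c
      c+x≡s′ : c + x ≡ s′
      c+x≡s′ = m+[n∸m]≡n (≤-trans (m≤m+n c 2) c+2≤s′)
      2≤x : 2 ≤ x
      2≤x = +-cancelˡ-≤ c 2 x (subst (c + 2 ≤_) (sym c+x≡s′) c+2≤s′)

-- The cases k < 3 and the conclusion

edgeless : ∀ n → Graph n
edgeless n = record { adj = λ _ _ → false ; sym = λ _ _ → refl ; irrefl = λ _ → refl }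

∣⊥∩⊥∣≡0 : ∀ n → ∣ ⊥ {n} ∩ ⊥ ∣ ≡ 0
∣⊥∩⊥∣≡0 n = trans (cong ∣_∣ (∩-idem (⊥ {n}))) (∣⊥∣≡0 n)

1≤1*suc*2^ : ∀ ℓ s → 1 ≤ 1 * suc ℓ * 2 ^ (1 * s)
1≤1*suc*2^ ℓ s = *-mono-≤ {1} {1 * suc ℓ} (s≤s z≤n) (m^n>0 2 (1 * s))

mainTheorem3 : ∀ (k : ℕ) → 1 ≤ k →
    Σ ℕ λ m → Σ ℕ λ C → 1 ≤ m × 1 ≤ C × Σ ℕ λ N →
    ∀ (n : ℕ) → N ≤ n → ∀ (s : ℕ) → ⌈log₂ n ⌉ ≤ s * s →
    Σ (Graph n) λ G →
    HasPairAtDistance G k (λ d → n ^ (2 * (k / 3)) ≤ m * d * 2 ^ (C * s))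
-- For k < 3 the exponent of n is 0, so any pair at positive distance will do: two different sets,
-- one jump apart in the edgeless graph, admit no walk of length zero.
mainTheorem3 1 _ = 1 , 1 , s≤s z≤n , s≤s z≤n , 3 , small
  where
  small : ∀ n → 3 ≤ n → ∀ s → ⌈log₂ n ⌉ ≤ s * s →
    Σ (Graph n) λ G → HasPairAtDistance G 1 (λ d → 1 ≤ 1 * d * 2 ^ (1 * s))
  small n@(suc (suc (suc r))) (s≤s (s≤s (s≤s z≤n))) s _ = edgeless n ,
    (inside ∷ outside ∷ ⊥ , (λ _ _ _ _ → refl) , cong suc (∣⊥∣≡0 (suc r))) ,
    (outside ∷ inside ∷ ⊥ , (λ _ _ _ _ → refl) , cong suc (∣⊥∣≡0 (suc r))) ,
    (1 , cons (∣⊥∩⊥∣≡0 (suc r)) nil) ,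
    λ { (suc ℓ) _ → 1≤1*suc*2^ ℓ s }
mainTheorem3 2 _ = 1 , 1 , s≤s z≤n , s≤s z≤n , 3 , small
  where
  small : ∀ n → 3 ≤ n → ∀ s → ⌈log₂ n ⌉ ≤ s * s →
    Σ (Graph n) λ G → HasPairAtDistance G 2 (λ d → 1 ≤ 1 * d * 2 ^ (1 * s))
  small n@(suc (suc (suc r))) (s≤s (s≤s (s≤s z≤n))) s _ = edgeless n ,
    (inside ∷ inside ∷ outside ∷ ⊥ , (λ _ _ _ _ → refl) , cong (2 +_) (∣⊥∣≡0 r)) ,
    (inside ∷ outside ∷ inside ∷ ⊥ , (λ _ _ _ _ → refl) , cong (2 +_) (∣⊥∣≡0 r)) ,
    (1 , cons (cong suc (∣⊥∩⊥∣≡0 r)) nil) ,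
    λ { (suc ℓ) _ → 1≤1*suc*2^ ℓ s }
mainTheorem3 k@(suc (suc (suc k′))) _ =
  distance-lower-bound (suc (suc k′)) (k / 3) (m≥n⇒m/n>0 {k} {3} (s≤s (s≤s (s≤s z≤n)))) (s≤s z≤n) (m/n*n≤m k 3)
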